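{- For every integer $n\ge 0$, there are at least $\left\lfloor \frac{1}{2\sqrt{2}}(1+\sqrt{2})^{n+1}\right\rfloor$ distinct $(n+2)$-planar-feasible vectors.
   Context: $\tau(G)$ is the number of spanning trees of a (multi)graph $G$ (parallel edges counted as distinct). For an edge $e$ of $G$, $G/e$ is the multigraph obtained by contracting $e$ and $G-e$ the graph obtained by deleting $e$. A vector $(t,u)^T$ of integers is $n$-planar-feasible if there exist a simple planar graph $G$ on at most $n$ vertices and an edge $e\in E(G)$ with $t=\tau(G/e)$ and $u=\tau(G-e)$. -}

module Defs where

open import Data.Nat as ℕ using (ℕ; zero; suc; _+_; _*_; _∸_; _^_)
open import Data.Bool using (Bool; true; false; _∧_; _∨_; not)
open import Data.Fin as Fin using (Fin; zero; suc; punchOut)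
open import Data.Fin.Properties using (<⇒≢)
open import Data.List using (List; []; _∷_; length; filter; removeAt; lookup; map; allFin)
open import Data.Bool.ListAction using (any; all)
open import Data.List.Relation.Unary.All using (All; []; _∷_)
open import Data.List.Relation.Unary.Unique.Propositional using (Unique)
open import Data.List.Membership.Propositional using (_∈_)
open import Data.Product using (Σ; _×_; _,_; proj₁; proj₂)
open import Data.Rational as ℚ using (ℚ; 0ℚ; 1ℚ)
open import Relation.Nullary using (¬_; does; yes; no)
open import Relation.Binary.PropositionalEquality using (_≡_; _≢_; sym)
open import Function using (Injective)
open import Data.Sum using (_⊎_)
open import Data.Bool using () renaming (_≟_ to _≟ᵇ_)
open import Data.List using (_++_)

-- Multigraphs: a vertex set Fin k and a list of edges (pairs of
-- vertices).  Parallel edges are distinct list entries.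

record Multigraph : Set where
  constructor mg
  field
    nV    : ℕ
    edges : List (Fin nV × Fin nV)

open Multigraph public

private
  _==_ : ∀ {k} → Fin k → Fin k → Bool
  x == y = does (x Fin.≟ y)

step : ∀ {k} → List (Fin k × Fin k) → (Fin k → Bool) → Fin k → Bool
step es r w = r w ∨ any (λ e → (r (proj₁ e) ∧ (proj₂ e == w)) ∨ (r (proj₂ e) ∧ (proj₁ e == w))) es

iter : ∀ {k} → ℕ → List (Fin k × Fin k) → (Fin k → Bool) → Fin k → Bool
iter zero    es r = r
iter (suc j) es r = iter j es (step es r)

-- (Fin k, es) is connected: every vertex is reachable from vertex 0
-- (k iterations of the expansion suffice).  The empty graph counts as
-- connected (never relevant below).
connected : (k : ℕ) → List (Fin k × Fin k) → Bool
connected zero    es = true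
connected (suc k) es = all (iter (suc k) es (λ w → w == zero)) (allFin (suc k))

-- a spanning tree = a minimally connected spanning subgraph:
-- connected, and removing any one of its edges disconnects it.
isSpanningTree : (k : ℕ) → List (Fin k × Fin k) → Bool
isSpanningTree k S =
  connected k S ∧ all (λ i → not (connected k (removeAt S i))) (allFin (length S))

-- all sub(multi)sets of the edge list, edges distinguished by position
sublists : ∀ {A : Set} → List A → List (List A)
sublists []       = [] ∷ []
sublists (x ∷ xs) = let r = sublists xs in map (x ∷_) r ++ r

τ : Multigraph → ℕ
τ (mg k es) = length (filter (λ S → isSpanningTree k S ≟ᵇ true) (sublists es))

-- Simple graphs on Fin k: each edge {x,y} is stored once as (x , y)
-- with x < y (no loops), and there are no repeated edges.

record SimpleGraph (k : ℕ) : Set where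
  field
    E        : List (Fin k × Fin k)
    ordered  : All (λ e → proj₁ e Fin.< proj₂ e) E
    noRepeat : Unique E

open SimpleGraph public

allAt : ∀ {A : Set} {P : A → Set} {xs : List A} → All P xs → (i : Fin (length xs)) → P (lookup xs i)
allAt (p ∷ ps) zero    = p
allAt (p ∷ ps) (suc i) = allAt ps i

-- vertex map of the contraction of edge (x , y), x ≢ y: y is merged
-- into x, and the remaining vertices are renumbered (y is removed).
contractMap : ∀ {k} (x y : Fin (suc k)) → x ≢ y → Fin (suc k) → Fin k
contractMap x y x≢y w with w Fin.≟ y
... | yes _   = punchOut {i = y} {j = x} (λ eq → x≢y (sym eq))
... | no w≢y  = punchOut {i = y} {j = w} (λ eq → w≢y (sym eq))

deleteEdge : ∀ {k} (G : SimpleGraph k) → Fin (length (E G)) → Multigraph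
deleteEdge {k} G i = mg k (removeAt (E G) i)

contractEdge : ∀ {k} (G : SimpleGraph (suc k)) → Fin (length (E G)) → Multigraph
contractEdge {k} G i =
  mg k (map (λ e → f (proj₁ e) , f (proj₂ e)) (removeAt (E G) i))
  where
    f = contractMap (proj₁ (lookup (E G) i)) (proj₂ (lookup (E G) i)) (<⇒≢ (allAt (ordered G) i))

-- Planarity, via straight-line drawings with rational coordinates.

Point : Set
Point = ℚ × ℚ

OnSegment : Point → Point → Point → Set
OnSegment p a b = Σ ℚ λ s → (0ℚ ℚ.≤ s) × (s ℚ.≤ 1ℚ) ×
  (proj₁ p ≡ proj₁ a ℚ.+ s ℚ.* (proj₁ b ℚ.- proj₁ a)) ×
  (proj₂ p ≡ proj₂ a ℚ.+ s ℚ.* (proj₂ b ℚ.- proj₂ a))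

record PlanarDrawing {k : ℕ} (G : SimpleGraph k) : Set where
  field
    pos       : Fin k → Point
    injective : Injective _≡_ _≡_ pos
    avoidVertices : ∀ {x y} → (x , y) ∈ E G → (w : Fin k) → w ≢ x → w ≢ y →
                    ¬ OnSegment (pos w) (pos x) (pos y)
    noCrossings : ∀ {x y x' y'} → (x , y) ∈ E G → (x' , y') ∈ E G → (x , y) ≢ (x' , y') →
                  (p : Point) → OnSegment p (pos x) (pos y) → OnSegment p (pos x') (pos y') →
                  Σ (Fin k) λ w → ((w ≡ x) ⊎ (w ≡ y)) × ((w ≡ x') ⊎ (w ≡ y')) × (p ≡ pos w)

Planar : ∀ {k} → SimpleGraph k → Set
Planar G = PlanarDrawing G

-- (t , u) is n-planar-feasible.  A graph with an edge has at least one
-- vertex, so its vertex count is written suc k.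

PlanarFeasible : ℕ → ℕ × ℕ → Set
PlanarFeasible n (t , u) =
  Σ ℕ λ k → (suc k ℕ.≤ n) × Σ (SimpleGraph (suc k)) λ G → Planar G ×
    Σ (Fin (length (E G))) λ e → (τ (contractEdge G e) ≡ t) × (τ (deleteEdge G e) ≡ u)

-- (1+√2)^j = pellA j + pellB j · √2
pellAB : ℕ → ℕ × ℕ
pellAB zero    = 1 , 0
pellAB (suc j) = let (a , b) = pellAB j in (a + 2 * b , a + b)

-- BelowBound n m  ⇔  m ≤ (1+√2)^(n+1) / (2√2)
-- Indeed, with (1+√2)^(n+1) = a + b√2 (a > 0):  2√2·m ≤ a + b√2
-- ⇔ (2m − b)√2 ≤ a ⇔ 2·(2m ∸ b)² ≤ a².
BelowBound : ℕ → ℕ → Set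
BelowBound n m = let (a , b) = pellAB (suc n) in 2 * ((2 * m ∸ b) ^ 2) ℕ.≤ a ^ 2

{-# OPTIONS --safe #-}

-- Single out an edge e = pq and read the rest of the graph as a two-terminal
-- network with vector (t , u) = (τ(G/e) , τ(G−e)).  Adding new vertices next to e
-- acts linearly on such vectors; put ρ = t/u ≥ 1.  One new vertex gives
--   A (t , u) = (t+u , u), with ρ ≥ 2,  and  B (t , u) = (2t+u , t+u), with 3/2 ≤ ρ ≤ 2.
-- Elements outside the image of A (so ρ ≤ 2) admit C (t , u) = (2t+2u , t+3u) at
-- the price of two vertices, landing in ρ ≤ 6/5, while an element A v is replaced
-- by E v = (12t+7u , 8t+5u), three vertices above v and landing in 6/5 < ρ ≤ 3/2.
-- The ratio separates the four images, except at the common values 3/2 and 2,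
-- where a collision would need one of the vectors (1 , 1) and (4 , 4), which do
-- not occur.  So every level has twice as many vectors as the
-- previous one plus as many as the one before that: the Pell recursion.  The only
-- element that this rule does not serve is the single edge (1 , 0) two levels up,
-- and K₄ with its vector (8 , 8) takes its place.
--
-- The drawings stay in the closed first quadrant with e on its boundary, so that
-- new vertices fit on the other side of e.

module Submission where

open import Defs
open import Data.Nat using (ℕ; zero; suc; _+_; _*_; _∸_; _^_; _≤_; _<_; _≤?_; z≤n; s≤s; z<s; s<s)
open import Data.Product using (Σ; ∃; _×_; _,_; proj₁; proj₂)
open import Data.List using (List; []; _∷_; _++_; map; length; lookup; removeAt; filter; allFin)
open import Data.List.Relation.Unary.All as All using (All; []; _∷_)
open import Data.List.Relation.Unary.Unique.Propositional using (Unique)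
open import Data.Bool using (Bool; true; false; T; _∧_; _∨_; not)
open import Data.Bool.Properties using (T?; T-∧; T-∨) renaming (_≟_ to _≟ᵇ_)
open import Data.Fin as Fin using (Fin; zero; suc; punchIn)
import Data.Fin.Properties as Fin
import Data.Integer as ℤ
open import Data.List.Membership.Propositional using (_∈_; find; lose)
open import Data.List.Membership.Propositional.Properties using (∈-map⁺; ∈-map⁻; ∈-++⁻; ∈-allFin)
open import Data.List.Properties using (filter-++; length-++; length-map; map-++; map-∘; map-id)
open import Data.List.Relation.Binary.Disjoint.Propositional using (Disjoint)
open import Data.List.Relation.Binary.Subset.Propositional using (_⊆_)
import Data.List.Relation.Unary.All.Properties as All
open import Data.List.Relation.Unary.AllPairs as AllPairs using (AllPairs; []; _∷_)
open import Data.List.Relation.Unary.Any using (here; there; index)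
import Data.List.Relation.Unary.Any.Properties as Any
import Data.List.Relation.Unary.Unique.Propositional.Properties as Unique
import Data.Nat.Properties as ℕ
open import Data.Nat.Tactic.RingSolver using (solve-∀)
open import Data.Rational as ℚ using (ℚ; 0ℚ; 1ℚ)
import Data.Rational.Properties as ℚ
open import Data.Rational.Solver using (module +-*-Solver)
open import Data.Sum using (_⊎_; inj₁; inj₂; swap) renaming (map to ⊎-map)
open import Data.Unit using (tt)
open import Function using (_∘_; id; _⇔_; mk⇔; Equivalence)
open import Function.Construct.Composition using (_⇔-∘_)
open import Function.Construct.Symmetry using (⇔-sym)
open import Relation.Binary.Construct.Closure.ReflexiveTransitive
  using (Star; ε; _◅_; _◅◅_; reverse; gmap; kleisliStar)
open import Relation.Binary.Definitions using (tri<; tri≈; tri>)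
open import Relation.Binary.PropositionalEquality
open import Relation.Nullary using (¬_; Dec; yes; no; contradiction; does)
open import Relation.Nullary.Decidable using (_×-dec_; ¬?; True; toWitness; decidable-stable; map′)
open Equivalence using (to; from)

private variable
  k k' m n : ℕ
  V W : Set

-- Connectivity and spanning trees

Edges : Set → Set
Edges V = List (V × V)

Adj : Edges V → V → V → Set
Adj es v w = (v , w) ∈ es ⊎ (w , v) ∈ es

Walk : Edges V → V → V → Set
Walk es = Star (Adj es)

Connected : Edges V → Set
Connected es = ∀ v w → Walk es v w

IsTree : Edges V → Set
IsTree es = Connected es × (∀ i → ¬ Connected (removeAt es i))

reverseWalk : (es : Edges V) {v w : V} → Walk es v w → Walk es w v
reverseWalk es = reverse swap

size : (Fin k → Bool) → ℕ
size {zero}  r = 0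
size {suc k} r with r zero
... | true  = suc (size (r ∘ suc))
... | false = size (r ∘ suc)

size-mono : (r s : Fin k → Bool) → (∀ w → T (r w) → T (s w)) → size r ≤ size s
size-mono {zero}  r s r⊆s = z≤n
size-mono {suc k} r s r⊆s with r zero | s zero | r⊆s zero | size-mono (r ∘ suc) (s ∘ suc) (r⊆s ∘ suc)
... | true  | true  | _ | le = s≤s le
... | true  | false | h | le with () ← h tt
... | false | true  | _ | le = ℕ.m≤n⇒m≤1+n le
... | false | false | _ | le = le

size-strict : (r s : Fin k → Bool) → (∀ w → T (r w) → T (s w)) →
              ∀ w → T (s w) → ¬ T (r w) → size r < size s
size-strict r s r⊆s zero sw ¬rw with r zero | s zero | size-mono (r ∘ suc) (s ∘ suc) (r⊆s ∘ suc)
... | true  | _    | _  = contradiction tt ¬rw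
... | false | true | le = s≤s le
size-strict r s r⊆s (suc w) sw ¬rw
  with r zero | s zero | r⊆s zero | size-strict (r ∘ suc) (s ∘ suc) (r⊆s ∘ suc) w sw ¬rw
... | true  | true  | _ | lt = s≤s lt
... | true  | false | h | lt with () ← h tt
... | false | true  | _ | lt = ℕ.m≤n⇒m≤1+n lt
... | false | false | _ | lt = lt

size≤k : (r : Fin k → Bool) → size r ≤ k
size≤k {zero}  r = z≤n
size≤k {suc k} r with r zero
... | true  = s≤s (size≤k (r ∘ suc))
... | false = ℕ.m≤n⇒m≤1+n (size≤k (r ∘ suc))

size-full : (r : Fin k → Bool) → k ≤ size r → ∀ w → T (r w)
size-full r k≤ w with T? (r w)
... | yes rw = rw
... | no ¬rw = contradiction
  (ℕ.<-≤-trans (size-strict r (λ _ → true) _ w tt ¬rw) (size≤k (λ _ → true))) (ℕ.≤⇒≯ k≤)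

private
  joins : (Fin k → Bool) → Fin k → Fin k × Fin k → Bool
  joins r w e = (r (proj₁ e) ∧ does (proj₂ e Fin.≟ w)) ∨ (r (proj₂ e) ∧ does (proj₁ e Fin.≟ w))

  does-sound : {A : Set} (a? : Dec A) → T (does a?) → A
  does-sound (yes a) _ = a

  does-complete : {A : Set} (a? : Dec A) → A → T (does a?)
  does-complete (yes _) _ = tt
  does-complete (no ¬a) a = ¬a a

step⁺ : (es : Edges (Fin k)) (r : Fin k → Bool) {v w : Fin k} →
        T (r v) → Adj es v w → T (step es r w)
step⁺ es r {v} {w} rv adj =
  from T-∨ (inj₂ (Any.any⁺ (joins r w) (witness adj)))
  where
    witness : Adj es v w → _
    witness (inj₁ e∈) = lose e∈ (from T-∨ (inj₁ (from T-∧ (rv , does-complete (w Fin.≟ w) refl))))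
    witness (inj₂ e∈) = lose e∈ (from T-∨ (inj₂ (from T-∧ (rv , does-complete (w Fin.≟ w) refl))))

step⁻ : (es : Edges (Fin k)) (r : Fin k → Bool) (w : Fin k) →
        T (step es r w) → T (r w) ⊎ ∃ λ v → T (r v) × Adj es v w
step⁻ es r w h with to T-∨ h
... | inj₁ rw = inj₁ rw
... | inj₂ anyE with find (Any.any⁻ (joins r w) es anyE)
... | (v , v') , e∈ , je with to T-∨ je
... | inj₁ both = let rv , v'w = to T-∧ both in
  inj₂ (v , rv , inj₁ (subst (λ u → (v , u) ∈ es) (does-sound (v' Fin.≟ w) v'w) e∈))
... | inj₂ both = let rv' , vw = to T-∧ both in
  inj₂ (v' , rv' , inj₂ (subst (λ u → (u , v') ∈ es) (does-sound (v Fin.≟ w) vw) e∈))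

step-⊇ : (es : Edges (Fin k)) (r : Fin k → Bool) {w : Fin k} → T (r w) → T (step es r w)
step-⊇ es r rw = from T-∨ (inj₁ rw)

iter-⊇ : ∀ j (es : Edges (Fin k)) (r : Fin k → Bool) {w} → T (r w) → T (iter j es r w)
iter-⊇ zero    es r rw = rw
iter-⊇ (suc j) es r rw = iter-⊇ j es (step es r) (step-⊇ es r rw)

-- `P` is left arbitrary because it is used twice: with walks from `zero` in `connected-sound`, and
-- with `T ∘ r` itself in `iter-closed`.
iter-sound : ∀ j (es : Edges (Fin k)) (r : Fin k → Bool) {P : Fin k → Set} →
             (∀ {v w} → Adj es v w → P v → P w) → (∀ {w} → T (r w) → P w) →
             ∀ {w} → T (iter j es r w) → P w
iter-sound zero    es r closed r⊆P rw = r⊆P rw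
iter-sound (suc j) es r {P} closed r⊆P = iter-sound j es (step es r) closed step⊆P
  where
    step⊆P : ∀ {w} → T (step es r w) → P w
    step⊆P {w} h with step⁻ es r w h
    ... | inj₁ rw             = r⊆P rw
    ... | inj₂ (v , rv , adj) = closed adj (r⊆P rv)

Closed : Edges (Fin k) → (Fin k → Bool) → Set
Closed es r = ∀ {v w} → Adj es v w → T (r v) → T (r w)

-- Every non-stationary step enlarges the reached set, so k steps suffice.
iter-closed : ∀ j (es : Edges (Fin k)) (r : Fin k → Bool) → k ≤ size r + j → Closed es (iter j es r)
iter-closed zero es r k≤ {w = w} _ _ = size-full r (subst (_ ≤_) (ℕ.+-identityʳ _) k≤) w
iter-closed {k} (suc j) es r k≤ with Fin.any? (λ w → T? (step es r w) ×-dec ¬? (T? (r w)))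
... | yes (w , sw , ¬rw) = iter-closed j es (step es r)
  (ℕ.≤-trans k≤ (ℕ.≤-trans (ℕ.≤-reflexive (ℕ.+-suc (size r) j))
    (ℕ.+-monoˡ-≤ j (size-strict r (step es r) (λ _ → step-⊇ es r) w sw ¬rw))))
-- A stationary step means that `r` is closed, so the later iterations never leave `r`.
... | no none = λ adj h → iter-⊇ (suc j) es r
  (closed adj (iter-sound (suc j) es r {T ∘ r} closed id h))
  where
    closed : Closed es r
    closed {w = w} adj rv = decidable-stable (T? (r w)) λ ¬rw → none (w , step⁺ es r rv adj , ¬rw)

connected-sound : (es : Edges (Fin (suc k))) → T (connected (suc k) es) → Connected es
connected-sound {k} es c v w = reverseWalk es (fromZero v) ◅◅ fromZero w
  where
    root : Fin (suc k) → Bool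
    root w = does (w Fin.≟ zero)
    fromZero : ∀ w → Walk es zero w
    fromZero w = iter-sound (suc k) es root (λ adj p → p ◅◅ (adj ◅ ε))
      (λ {w} h → subst (Walk es zero) (sym (does-sound (w Fin.≟ zero) h)) ε)
      (All.lookup (All.all⁺ _ (allFin (suc k)) c) (∈-allFin w))

-- The final set contains `zero` and is closed under adjacency, so every walk from `zero` stays in
-- it.
connected-complete : (es : Edges (Fin (suc k))) → Connected es → T (connected (suc k) es)
connected-complete {k} es c = All.all⁻ _ {allFin (suc k)} (All.tabulate λ {w} _ → follow (c zero w) (iter-⊇ (suc k) es root {zero} tt))
  where
    root : Fin (suc k) → Bool
    root w = does (w Fin.≟ zero)
    follow : ∀ {v w} → Walk es v w → T (iter (suc k) es root v) → T (iter (suc k) es root w)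
    follow ε h = h
    follow (adj ◅ p) h = follow p (iter-closed (suc k) es root (ℕ.m≤n+m (suc k) (size root)) adj h)

T-not⁺ : ∀ {b} → ¬ T b → T (not b)
T-not⁺ {false} _ = tt
T-not⁺ {true}  n = n tt

T-not⁻ : ∀ {b} → T (not b) → ¬ T b
T-not⁻ {false} _ ()

isSpanningTree⇔ : (S : Edges (Fin (suc k))) → T (isSpanningTree (suc k) S) ⇔ IsTree S
isSpanningTree⇔ {k} S = mk⇔ sound complete
  where
    sound : T (isSpanningTree (suc k) S) → IsTree S
    sound t with to T-∧ t
    ... | c , m = connected-sound S c , λ i ci →
      T-not⁻ (All.lookup (All.all⁺ _ (allFin (length S)) m) (∈-allFin i)) (connected-complete (removeAt S i) ci)
    complete : IsTree S → T (isSpanningTree (suc k) S)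
    complete (c , m) = from T-∧ (connected-complete S c ,
      All.all⁻ _ {allFin (length S)} (All.tabulate λ {i} _ → T-not⁺ (m i ∘ connected-sound (removeAt S i))))

-- Deletion and contraction

rename : (V → W) → Edges V → Edges W
rename f = map (λ e → f (proj₁ e) , f (proj₂ e))

bindWalk : {es : Edges V} {es' : Edges W} (f : V → W) → (∀ {v w} → Adj es v w → Walk es' (f v) (f w)) →
           ∀ {v w} → Walk es v w → Walk es' (f v) (f w)
bindWalk f g = kleisliStar f g

Adj-rename : (f : V → W) (es : Edges V) {v w : V} → Adj es v w → Adj (rename f es) (f v) (f w)
Adj-rename f es = ⊎-map (∈-map⁺ _) (∈-map⁺ _)

removeAt-rename : (f : V → W) (es : Edges V) (i : Fin (length (rename f es))) →
                  ∃ λ j → removeAt (rename f es) i ≡ rename f (removeAt es j)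
removeAt-rename f (e ∷ es) zero    = zero , refl
removeAt-rename f (e ∷ es) (suc i) with removeAt-rename f es i
... | j , eq = suc j , cong (_ ∷_) eq

rename-removeAt : (f : V → W) (es : Edges V) (j : Fin (length es)) →
                  ∃ λ i → removeAt (rename f es) i ≡ rename f (removeAt es j)
rename-removeAt f (e ∷ es) zero    = zero , refl
rename-removeAt f (e ∷ es) (suc j) with rename-removeAt f es j
... | i , eq = suc i , cong (_ ∷_) eq

∈-removeAt : {A : Set} {x : A} (xs : List A) (i : Fin (length xs)) →
             x ∈ xs → x ≡ lookup xs i ⊎ x ∈ removeAt xs i
∈-removeAt (x ∷ xs) zero    (here eq)  = inj₁ eq
∈-removeAt (x ∷ xs) zero    (there x∈) = inj₂ x∈
∈-removeAt (x ∷ xs) (suc i) (here eq)  = inj₂ (here eq)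
∈-removeAt (x ∷ xs) (suc i) (there x∈) = ⊎-map id there (∈-removeAt xs i x∈)

Off : Edges V → V → V → V → Set
Off es x v w = Adj es v w × v ≢ x × w ≢ x

-- An exit found in the tail is kept. Otherwise the tail stays off `x`, and the last exit happens
-- here precisely if `u` is `x`.
lastExit : (es : Edges (Fin k)) (x : Fin k) {u y : Fin k} → y ≢ x → Walk es u y →
           (u ≢ x × Star (Off es x) u y) ⊎ ∃ λ w → Adj es x w × w ≢ x × Star (Off es x) w y
lastExit es x y≢x ε = inj₁ (y≢x , ε)
lastExit es x {u} y≢x (adj ◅ p) with lastExit es x y≢x p
... | inj₂ exit = inj₂ exit
... | inj₁ (v≢x , q) with u Fin.≟ x
...   | yes refl = inj₂ (_ , adj , v≢x , q)
...   | no u≢x   = inj₁ (u≢x , (adj , u≢x , v≢x) ◅ q)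

-- An x–y walk, cut at its last exit from x, uses its first edge only once;
-- once x and y are joined by a new edge, that edge is therefore superfluous.
superfluous : (es : Edges (Fin k)) {x y : Fin k} → x ≢ y → Connected es →
              ∃ λ i → Connected ((x , y) ∷ removeAt es i)
superfluous {k} es {x} {y} x≢y conn with lastExit es x (x≢y ∘ sym) (conn x y)
... | inj₁ (x≢x , _) = contradiction refl x≢x
... | inj₂ (w , adj , w≢x , p) = i , λ v v' → bindWalk id reroute (conn v v')
  where
    locate : Adj es x w → ∃ λ i → lookup es i ≡ (x , w) ⊎ lookup es i ≡ (w , x)
    locate (inj₁ e∈) = index e∈ , inj₁ (sym (Any.lookup-index e∈))
    locate (inj₂ e∈) = index e∈ , inj₂ (sym (Any.lookup-index e∈))
    i = proj₁ (locate adj)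
    es' = (x , y) ∷ removeAt es i
    ends : ∀ {a b} → (a , b) ≡ lookup es i → (a ≡ x × b ≡ w) ⊎ (a ≡ w × b ≡ x)
    ends eq with proj₂ (locate adj)
    ... | inj₁ at with refl ← trans eq at = inj₁ (refl , refl)
    ... | inj₂ at with refl ← trans eq at = inj₂ (refl , refl)
    keep : ∀ {a b} → (a , b) ∈ es → a ≢ x → b ≢ x → (a , b) ∈ es'
    keep e∈ a≢x b≢x with ∈-removeAt es i e∈
    ... | inj₂ e∈' = there e∈'
    ... | inj₁ eq with ends eq
    ...   | inj₁ (a≡x , _) = contradiction a≡x a≢x
    ...   | inj₂ (_ , b≡x) = contradiction b≡x b≢x
    off : ∀ {a b} → Off es x a b → Walk es' a b
    off (inj₁ e∈ , a≢x , b≢x) = inj₁ (keep e∈ a≢x b≢x) ◅ ε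
    off (inj₂ e∈ , a≢x , b≢x) = inj₂ (keep e∈ b≢x a≢x) ◅ ε
    wy : Walk es' w y
    wy = kleisliStar id off p
    -- The detour through `y` and the new edge replaces the removed edge between `x` and `w`.
    wx : Walk es' w x
    wx = wy ◅◅ (inj₂ (here refl) ◅ ε)
    edge : ∀ {a b} → (a , b) ∈ es → Walk es' a b
    edge e∈ with ∈-removeAt es i e∈
    ... | inj₂ e∈' = inj₁ (there e∈') ◅ ε
    ... | inj₁ eq with ends eq
    ...   | inj₁ (refl , refl) = reverseWalk es' wx
    ...   | inj₂ (refl , refl) = wx
    reroute : ∀ {a b} → Adj es a b → Walk es' a b
    reroute (inj₁ e∈) = edge e∈
    reroute (inj₂ e∈) = reverseWalk es' (edge e∈)

-- A quotient map whose fibres are joined by the edge `(x , y)` alone. Keeping the map abstract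
-- allows `contractMap` to be exchanged for maps with simpler renumbering.
record Contracts (f : V → W) (x y : V) : Set where
  field
    onto   : ∀ w → ∃ λ v → f v ≡ w
    glue   : f x ≡ f y
    kernel : ∀ {v w} → f v ≡ f w → Walk ((x , y) ∷ []) v w

open Contracts

private
  here⊆ : {e : V × V} {es : Edges V} {v w : V} → Adj (e ∷ []) v w → Adj (e ∷ es) v w
  here⊆ (inj₁ (here eq)) = inj₁ (here eq)
  here⊆ (inj₂ (here eq)) = inj₂ (here eq)

-- Downwards, steps along `(x , y)` collapse. Upwards, each edge of a walk is lifted separately, and
-- consecutive lifts are joined inside a fibre by `kernel`.
connected-contract : {f : V → W} {x y : V} → Contracts f x y → (es : Edges V) →
                     Connected ((x , y) ∷ es) ⇔ Connected (rename f es)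
connected-contract {f = f} {x} {y} c es = mk⇔ down up
  where
    pushAdj : ∀ {v w} → Adj ((x , y) ∷ es) v w → Walk (rename f es) (f v) (f w)
    pushAdj (inj₁ (here refl)) rewrite glue c = ε
    pushAdj (inj₂ (here refl)) rewrite glue c = ε
    pushAdj (inj₁ (there e∈)) = Adj-rename f es (inj₁ e∈) ◅ ε
    pushAdj (inj₂ (there e∈)) = Adj-rename f es (inj₂ e∈) ◅ ε
    down : Connected ((x , y) ∷ es) → Connected (rename f es)
    down conn a b with onto c a | onto c b
    ... | v , refl | w , refl = bindWalk f pushAdj (conn v w)
    inClass : ∀ {v w} → f v ≡ f w → Walk ((x , y) ∷ es) v w
    inClass eq = gmap id here⊆ (kernel c eq)
    lift : ∀ {a b} → Walk (rename f es) a b → ∀ v w → f v ≡ a → f w ≡ b → Walk ((x , y) ∷ es) v w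
    lift ε v w va wb = inClass (trans va (sym wb))
    lift (inj₁ e∈ ◅ p) v w va wb with ∈-map⁻ _ e∈
    ... | (r , s) , rs∈ , refl =
      inClass va ◅◅ (inj₁ (there rs∈) ◅ lift p s w refl wb)
    lift (inj₂ e∈ ◅ p) v w va wb with ∈-map⁻ _ e∈
    ... | (r , s) , rs∈ , refl =
      inClass va ◅◅ (inj₂ (there rs∈) ◅ lift p r w refl wb)
    up : Connected (rename f es) → Connected ((x , y) ∷ es)
    up conn v w = lift (conn (f v) (f w)) v w refl refl

tree-contract : {f : Fin k → W} {x y : Fin k} → Contracts f x y → x ≢ y → (es : Edges (Fin k)) →
                IsTree ((x , y) ∷ es) ⇔ IsTree (rename f es)
tree-contract {k} {f = f} {x} {y} c x≢y es = mk⇔ down up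
  where
    down : IsTree ((x , y) ∷ es) → IsTree (rename f es)
    down (conn , minimal) = to (connected-contract c es) conn , λ i conn' →
      let j , eq = removeAt-rename f es i in
      minimal (suc j) (from (connected-contract c (removeAt es j)) (subst Connected eq conn'))
    up : IsTree (rename f es) → IsTree ((x , y) ∷ es)
    up (conn , minimal) = from (connected-contract c es) conn , minimal'
      where
        keepEdge : ∀ j → ¬ Connected ((x , y) ∷ removeAt es j)
        keepEdge j conn' =
          let i , eq = rename-removeAt f es j in
          minimal i (subst Connected (sym eq) (to (connected-contract c (removeAt es j)) conn'))
        minimal' : ∀ i → ¬ Connected (removeAt ((x , y) ∷ es) i)
        minimal' zero    conn' = let j , conn'' = superfluous es x≢y conn' in keepEdge j conn''
        minimal' (suc j) conn' = keepEdge j conn'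

tree-loopless : (x : V) (es : Edges V) → ¬ IsTree ((x , x) ∷ es)
tree-loopless x es (conn , minimal) = minimal zero λ v w → bindWalk id drop (conn v w)
  where
    drop : ∀ {v w} → Adj ((x , x) ∷ es) v w → Walk es v w
    drop (inj₁ (here refl)) = ε
    drop (inj₂ (here refl)) = ε
    drop (inj₁ (there e∈))  = inj₁ e∈ ◅ ε
    drop (inj₂ (there e∈))  = inj₂ e∈ ◅ ε

-- Counting spanning trees over sublists.

count : {A : Set} → (A → Bool) → List A → ℕ
count p xs = length (filter (λ x → p x ≟ᵇ true) xs)

count-++ : {A : Set} (p : A → Bool) (xs ys : List A) → count p (xs ++ ys) ≡ count p xs + count p ys
count-++ p xs ys = trans (cong length (filter-++ _ xs ys)) (length-++ (filter _ xs))

count-map : {A B : Set} (p : B → Bool) (f : A → B) (xs : List A) → count p (map f xs) ≡ count (p ∘ f) xs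
count-map p f [] = refl
count-map p f (x ∷ xs) with p (f x)
... | true  = cong suc (count-map p f xs)
... | false = count-map p f xs

count-cong : {A : Set} (p q : A → Bool) → (∀ x → T (p x) ⇔ T (q x)) → (xs : List A) → count p xs ≡ count q xs
count-cong p q p⇔q [] = refl
count-cong p q p⇔q (x ∷ xs) with p x | q x | p⇔q x
... | true  | true  | _ = cong suc (count-cong p q p⇔q xs)
... | false | false | _ = count-cong p q p⇔q xs
... | true  | false | h with () ← to h _
... | false | true  | h with () ← from h _

count-none : {A : Set} (p : A → Bool) → (∀ x → ¬ T (p x)) → (xs : List A) → count p xs ≡ 0
count-none p none [] = refl
count-none p none (x ∷ xs) with p x | none x
... | true  | h = contradiction _ h
... | false | _ = count-none p none xs

sublists-map : {A B : Set} (f : A → B) (xs : List A) → sublists (map f xs) ≡ map (map f) (sublists xs)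
sublists-map f [] = refl
sublists-map f (x ∷ xs) rewrite sublists-map f xs = begin
  map (f x ∷_) (map (map f) ss) ++ map (map f) ss  ≡⟨ cong (_++ map (map f) ss) (map-∘ ss) ⟨
  map (map f ∘ (x ∷_)) ss ++ map (map f) ss        ≡⟨ cong (_++ map (map f) ss) (map-∘ ss) ⟩
  map (map f) (map (x ∷_) ss) ++ map (map f) ss    ≡⟨ map-++ (map f) (map (x ∷_) ss) ss ⟨
  map (map f) (map (x ∷_) ss ++ ss)                ∎
  where
    open ≡-Reasoning
    ss = sublists xs

τ-split : ∀ k (e : Fin k × Fin k) (es : Edges (Fin k)) →
          τ (mg k (e ∷ es)) ≡ count (isSpanningTree k ∘ (e ∷_)) (sublists es) + τ (mg k es)
τ-split k e es = trans (count-++ (isSpanningTree k) (map (e ∷_) (sublists es)) (sublists es))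
  (cong (_+ τ (mg k es)) (count-map (isSpanningTree k) (e ∷_) (sublists es)))

-- Sublists are matched by position, so edges that become parallel stay distinct, and
-- `tree-contract` applies to each sublist. The right-hand side counts the spanning trees through
-- `(x , y)`.
τ-rename : {f : Fin (suc k) → Fin (suc k')} {x y : Fin (suc k)} → Contracts f x y → x ≢ y →
           (es : Edges (Fin (suc k))) →
           τ (mg (suc k') (rename f es)) ≡ count (isSpanningTree (suc k) ∘ ((x , y) ∷_)) (sublists es)
τ-rename {k} {k'} {f} {x} {y} c x≢y es = begin
  count (isSpanningTree (suc k')) (sublists (rename f es))
    ≡⟨ cong (count _) (sublists-map _ es) ⟩
  count (isSpanningTree (suc k')) (map (rename f) (sublists es))
    ≡⟨ count-map _ (rename f) (sublists es) ⟩
  count (isSpanningTree (suc k') ∘ rename f) (sublists es)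
    ≡⟨ count-cong _ _ (λ S → ⇔-sym (isSpanningTree⇔ ((x , y) ∷ S))
         ⇔-∘ (⇔-sym (tree-contract c x≢y S) ⇔-∘ isSpanningTree⇔ (rename f S))) (sublists es) ⟩
  count (isSpanningTree (suc k) ∘ ((x , y) ∷_)) (sublists es) ∎
  where open ≡-Reasoning

τ-deletion-contraction : {f : Fin (suc k) → Fin (suc k')} {x y : Fin (suc k)} → Contracts f x y → x ≢ y →
  (es : Edges (Fin (suc k))) →
  τ (mg (suc k) ((x , y) ∷ es)) ≡ τ (mg (suc k') (rename f es)) + τ (mg (suc k) es)
τ-deletion-contraction {k} {x = x} {y} c x≢y es =
  trans (τ-split (suc k) (x , y) es) (cong (_+ τ (mg (suc k) es)) (sym (τ-rename c x≢y es)))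

-- The right-hand side of `τ-rename` does not mention the map. This trades `contractMap` for `slide`
-- or a lifted map.
τ-contraction-unique : {f : Fin (suc k) → Fin (suc k')} {g : Fin (suc k) → Fin (suc k')} {x y : Fin (suc k)} →
  Contracts f x y → Contracts g x y → x ≢ y → (es : Edges (Fin (suc k))) →
  τ (mg (suc k') (rename f es)) ≡ τ (mg (suc k') (rename g es))
τ-contraction-unique cf cg x≢y es = trans (τ-rename cf x≢y es) (sym (τ-rename cg x≢y es))

τ-loop : (x : Fin (suc k)) (es : Edges (Fin (suc k))) → τ (mg (suc k) ((x , x) ∷ es)) ≡ τ (mg (suc k) es)
τ-loop {k} x es = trans (τ-split (suc k) (x , x) es) (cong (_+ τ (mg (suc k) es))
  (count-none _ (λ S t → tree-loopless x S (to (isSpanningTree⇔ ((x , x) ∷ S)) t)) (sublists es)))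

shift : Edges (Fin k) → Edges (Fin (suc k))
shift = rename suc

τ-isolated : (es : Edges (Fin (suc k))) → τ (mg (suc (suc k)) (shift es)) ≡ 0
τ-isolated {k} es = begin
  count tree? (sublists (shift es))           ≡⟨ cong (count tree?) (sublists-map _ es) ⟩
  count tree? (map shift (sublists es))       ≡⟨ count-map tree? shift (sublists es) ⟩
  count (tree? ∘ shift) (sublists es)         ≡⟨ count-none _ (λ S t → isolated S (proj₁ (to (isSpanningTree⇔ (shift S)) t) zero (suc zero))) (sublists es) ⟩
  0                                           ∎
  where
    open ≡-Reasoning
    tree? = isSpanningTree (suc (suc k))
    isolated : ∀ (S : Edges (Fin (suc k))) {w} → ¬ Walk (shift S) zero (suc w)
    isolated S (inj₁ e∈ ◅ _) with ∈-map⁻ _ e∈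
    ... | _ , _ , ()
    isolated S (inj₂ e∈ ◅ _) with ∈-map⁻ _ e∈
    ... | _ , _ , ()

-- Graphs with a distinguished edge

open Contracts

contractMap-contracts : (x y : Fin (suc k)) (x≢y : x ≢ y) → Contracts (contractMap x y x≢y) x y
contractMap-contracts {k} x y x≢y = record { onto = onto' ; glue = glue' ; kernel = kernel' }
  where
    onto' : ∀ w → ∃ λ v → contractMap x y x≢y v ≡ w
    onto' w = punchIn y w , at
      where
        at : contractMap x y x≢y (punchIn y w) ≡ w
        at with punchIn y w Fin.≟ y
        ... | yes eq = contradiction eq (Fin.punchInᵢ≢i y w)
        ... | no _   = trans (Fin.punchOut-cong y refl) (Fin.punchOut-punchIn y)
    glue' : contractMap x y x≢y x ≡ contractMap x y x≢y y
    glue' with x Fin.≟ y | y Fin.≟ y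
    ... | yes eq | _      = contradiction eq x≢y
    ... | no _   | yes _  = Fin.punchOut-cong y refl
    ... | no _   | no y≢y = contradiction refl y≢y
    kernel' : ∀ {v w} → contractMap x y x≢y v ≡ contractMap x y x≢y w → Walk ((x , y) ∷ []) v w
    kernel' {v} {w} eq with v Fin.≟ y | w Fin.≟ y
    ... | yes refl | yes refl = ε
    ... | yes refl | no _ with refl ← Fin.punchOut-injective {i = y} _ _ eq = inj₂ (here refl) ◅ ε
    ... | no _ | yes refl with refl ← Fin.punchOut-injective {i = y} _ _ eq = inj₁ (here refl) ◅ ε
    ... | no _ | no _ with refl ← Fin.punchOut-injective {i = y} _ _ eq = ε

-- Merges the new vertex `zero` into `r` and restores the old labels, so that contracting a spoke
-- turns `shift es` back into `es`.
slide : Fin k → Fin (suc k) → Fin k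
slide r zero    = r
slide r (suc v) = v

slide-contracts : (r : Fin k) → Contracts (slide r) zero (suc r)
slide-contracts r = record { onto = λ w → suc w , refl ; glue = refl ; kernel = kernel' }
  where
    kernel' : ∀ {v w} → slide r v ≡ slide r w → Walk ((zero , suc r) ∷ []) v w
    kernel' {zero}  {zero}  refl = ε
    kernel' {zero}  {suc w} refl = inj₁ (here refl) ◅ ε
    kernel' {suc v} {zero}  refl = inj₂ (here refl) ◅ ε
    kernel' {suc v} {suc w} refl = ε

rename-slide : (r : Fin k) (es : Edges (Fin k)) → rename (slide r) (shift es) ≡ es
rename-slide r es = trans (sym (map-∘ es)) (map-id es)

lift-contracts : {f : Fin (suc k) → Fin m} {x y : Fin (suc k)} → Contracts f x y →
                 Contracts (Fin.lift 1 f) (suc x) (suc y)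
lift-contracts {f = f} {x} {y} c = record { onto = onto' ; glue = cong suc (glue c) ; kernel = kernel' }
  where
    onto' : ∀ w → ∃ λ v → Fin.lift 1 f v ≡ w
    onto' zero    = zero , refl
    onto' (suc w) = let v , eq = onto c w in suc v , cong suc eq
    edge : ∀ {v w} → Adj ((x , y) ∷ []) v w → Walk ((suc x , suc y) ∷ []) (suc v) (suc w)
    edge (inj₁ (here refl)) = inj₁ (here refl) ◅ ε
    edge (inj₂ (here refl)) = inj₂ (here refl) ◅ ε
    kernel' : ∀ {v w} → Fin.lift 1 f v ≡ Fin.lift 1 f w → Walk ((suc x , suc y) ∷ []) v w
    kernel' {zero}  {zero}  eq = ε
    kernel' {suc v} {suc w} eq = bindWalk suc edge (kernel c (Fin.suc-injective eq))

rename-lift : (f : Fin k → Fin m) (es : Edges (Fin k)) → rename (Fin.lift 1 f) (shift es) ≡ shift (rename f es)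
rename-lift f es = trans (sym (map-∘ es)) (map-∘ es)

τ[_] : ∀ {k} → Edges (Fin k) → ℕ
τ[_] {k} es = τ (mg k es)

-- Deleting the only edge at `zero` isolates that vertex, so only the contraction contributes.
τ-pendant : (r : Fin (suc k)) (es : Edges (Fin (suc k))) → τ[ (zero , suc r) ∷ shift es ] ≡ τ[ es ]
τ-pendant r es = begin
  τ[ (zero , suc r) ∷ shift es ]                       ≡⟨ τ-deletion-contraction (slide-contracts r) (λ ()) (shift es) ⟩
  τ[ rename (slide r) (shift es) ] + τ[ shift es ]     ≡⟨ cong₂ _+_ (cong τ[_] (rename-slide r es)) (τ-isolated es) ⟩
  τ[ es ] + 0                                          ≡⟨ ℕ.+-identityʳ _ ⟩
  τ[ es ]                                              ∎
  where open ≡-Reasoning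

-- Contracting the first edge shortens the path to a single edge `(p , q)`; deleting it leaves a
-- pendant edge.
τ-path : (p q : Fin (suc k)) (es : Edges (Fin (suc k))) →
         τ[ (zero , suc p) ∷ (zero , suc q) ∷ shift es ] ≡ τ[ (p , q) ∷ es ] + τ[ es ]
τ-path p q es = begin
  τ[ (zero , suc p) ∷ (zero , suc q) ∷ shift es ]
    ≡⟨ τ-deletion-contraction (slide-contracts p) (λ ()) ((zero , suc q) ∷ shift es) ⟩
  τ[ (p , q) ∷ rename (slide p) (shift es) ] + τ[ (zero , suc q) ∷ shift es ]
    ≡⟨ cong₂ _+_ (cong (λ es' → τ[ (p , q) ∷ es' ]) (rename-slide p es)) (τ-pendant q es) ⟩
  τ[ (p , q) ∷ es ] + τ[ es ] ∎
  where open ≡-Reasoning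

-- The distinguished edge heads the edge list, so that removing index `zero` computes to `rest`. New
-- vertices are always numbered `zero`, which keeps their edges ordered.
record Frame (n : ℕ) : Set where
  field
    p q     : Fin (2 + n)
    rest    : Edges (Fin (2 + n))
    p<q     : p Fin.< q
    sorted  : All (λ e → proj₁ e Fin.< proj₂ e) rest
    uniq    : Unique ((p , q) ∷ rest)

  full : Edges (Fin (2 + n))
  full = (p , q) ∷ rest

  graph : SimpleGraph (2 + n)
  graph = record { E = full ; ordered = p<q ∷ sorted ; noRepeat = uniq }

  p≢q : p ≢ q
  p≢q = Fin.<⇒≢ p<q

  κ : Fin (2 + n) → Fin (1 + n)
  κ = contractMap p q p≢q

  κ-contracts : Contracts κ p q
  κ-contracts = contractMap-contracts p q p≢q

  t u : ℕ
  t = τ (contractEdge graph zero)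
  u = τ (deleteEdge graph zero)

  τ-full : τ[ full ] ≡ t + u
  τ-full = τ-deletion-contraction κ-contracts p≢q rest

  t-via : {f : Fin (2 + n) → Fin (1 + n)} → Contracts f p q → t ≡ τ[ rename f rest ]
  t-via c = τ-contraction-unique κ-contracts c p≢q rest

open Frame

vec : Frame n → ℕ × ℕ
vec F = t F , u F

shift-sorted : {es : Edges (Fin k)} → All (λ e → proj₁ e Fin.< proj₂ e) es →
               All (λ e → proj₁ e Fin.< proj₂ e) (shift es)
shift-sorted = All.map⁺ ∘ All.map s<s

shift-unique : {es : Edges (Fin k)} → Unique es → Unique (shift es)
shift-unique = Unique.map⁺ λ { refl → refl }

zero∉shift : {v : Fin (suc k)} (es : Edges (Fin k)) → All ((zero , v) ≢_) (shift es)
zero∉shift es = All.map⁺ (All.universal (λ _ ()) es)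

-- Each joins a new vertex to both ends of `pq`. `subdivide` drops `pq` and distinguishes the new
-- edge at `p`; `triangle` does the same but keeps `pq`; `parallel` keeps `pq` as the distinguished
-- edge.
subdivide triangle parallel : Frame n → Frame (suc n)
subdivide F = record
  { p = zero ; q = suc (p F)
  ; rest = (zero , suc (q F)) ∷ shift (rest F)
  ; p<q = z<s
  ; sorted = z<s ∷ shift-sorted (sorted F)
  ; uniq = ((λ { refl → p≢q F refl }) ∷ zero∉shift (rest F)) ∷ zero∉shift (rest F) ∷ shift-unique (AllPairs.tail (uniq F))
  }
triangle F = record
  { p = zero ; q = suc (p F)
  ; rest = (zero , suc (q F)) ∷ shift (full F)
  ; p<q = z<s
  ; sorted = z<s ∷ shift-sorted (p<q F ∷ sorted F)
  ; uniq = ((λ { refl → p≢q F refl }) ∷ zero∉shift (full F)) ∷ zero∉shift (full F) ∷ shift-unique (uniq F)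
  }
parallel F = record
  { p = suc (p F) ; q = suc (q F)
  ; rest = (zero , suc (p F)) ∷ (zero , suc (q F)) ∷ shift (rest F)
  ; p<q = s<s (p<q F)
  ; sorted = z<s ∷ z<s ∷ shift-sorted (sorted F)
  ; uniq = ((λ ()) ∷ (λ ()) ∷ AllPairs.head (shift-unique (uniq F)))
         ∷ ((λ { refl → p≢q F refl }) ∷ zero∉shift (rest F))
         ∷ zero∉shift (rest F)
         ∷ AllPairs.tail (shift-unique (uniq F))
  }

subdivideᵛ triangleᵛ parallelᵛ : ℕ × ℕ → ℕ × ℕ
subdivideᵛ (t , u) = t + u , u
triangleᵛ  (t , u) = t + (t + u) , t + u
parallelᵛ  (t , u) = t + t , (t + u) + u

-- Contracting the new edge restores the graph of `F`; deleting it leaves `rest F` with a pendant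
-- edge.
vec-subdivide : (F : Frame n) → vec (subdivide F) ≡ subdivideᵛ (vec F)
vec-subdivide F = cong₂ _,_
  (begin
    t (subdivide F)                                     ≡⟨ t-via (subdivide F) (slide-contracts (p F)) ⟩
    τ[ (p F , q F) ∷ rename (slide (p F)) (shift (rest F)) ]
      ≡⟨ cong (λ es → τ[ (p F , q F) ∷ es ]) (rename-slide (p F) (rest F)) ⟩
    τ[ full F ]                                         ≡⟨ τ-full F ⟩
    t F + u F                                           ∎)
  (τ-pendant (q F) (rest F))
  where open ≡-Reasoning

-- Contraction doubles `pq`. Contracting one copy turns the other into a loop, which lies in no
-- spanning tree.
vec-triangle : (F : Frame n) → vec (triangle F) ≡ triangleᵛ (vec F)
vec-triangle F = cong₂ _,_
  (begin
    t (triangle F)                                      ≡⟨ t-via (triangle F) (slide-contracts (p F)) ⟩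
    τ[ (p F , q F) ∷ rename (slide (p F)) (shift (full F)) ]
      ≡⟨ cong (λ es → τ[ (p F , q F) ∷ es ]) (rename-slide (p F) (full F)) ⟩
    τ[ (p F , q F) ∷ full F ]                           ≡⟨ τ-deletion-contraction (κ-contracts F) (p≢q F) (full F) ⟩
    τ[ (κ F (p F) , κ F (q F)) ∷ rename (κ F) (rest F) ] + τ[ full F ]
      ≡⟨ cong₂ _+_ loop (τ-full F) ⟩
    t F + (t F + u F)                                   ∎)
  (trans (τ-pendant (q F) (full F)) (τ-full F))
  where
    open ≡-Reasoning
    loop : τ[ (κ F (p F) , κ F (q F)) ∷ rename (κ F) (rest F) ] ≡ t F
    loop = trans (cong (λ r → τ[ (r , κ F (q F)) ∷ rename (κ F) (rest F) ]) (glue (κ-contracts F)))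
                 (τ-loop (κ F (q F)) (rename (κ F) (rest F)))

-- After contraction the added path is a pair of parallel edges, and `τ-path` replaces it by a loop,
-- whence the term `t F` twice.
vec-parallel : (F : Frame n) → vec (parallel F) ≡ parallelᵛ (vec F)
vec-parallel F = cong₂ _,_
  (begin
    t (parallel F)
      ≡⟨ t-via (parallel F) (lift-contracts (κ-contracts F)) ⟩
    τ[ (zero , suc p') ∷ (zero , suc q') ∷ rename (Fin.lift 1 (κ F)) (shift (rest F)) ]
      ≡⟨ cong (λ es → τ[ (zero , suc p') ∷ (zero , suc q') ∷ es ]) (rename-lift (κ F) (rest F)) ⟩
    τ[ (zero , suc p') ∷ (zero , suc q') ∷ shift rest' ]
      ≡⟨ τ-path p' q' rest' ⟩
    τ[ (p' , q') ∷ rest' ] + t F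
      ≡⟨ cong (_+ t F) (trans (cong (λ r → τ[ (r , q') ∷ rest' ]) (glue (κ-contracts F))) (τ-loop q' rest')) ⟩
    t F + t F ∎)
  (trans (τ-path (p F) (q F) (rest F)) (cong (_+ u F) (τ-full F)))
  where
    open ≡-Reasoning
    p' = κ F (p F)
    q' = κ F (q F)
    rest' = rename (κ F) (rest F)

edge₀ : Frame 0
edge₀ = record { p = zero ; q = suc zero ; rest = [] ; p<q = z<s ; sorted = [] ; uniq = [] ∷ [] }

vec-edge : vec edge₀ ≡ (1 , 0)
vec-edge = refl

-- `parallel (triangle edge₀)` has five of the six edges; the one from vertex 0 to vertex 3 is
-- added. Of the 16 spanning trees, each with three of the six edges, eight contain any given edge.
K₄ : Frame 2
K₄ = record
  { p = suc zero ; q = suc (suc zero)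
  ; rest = (zero , suc (suc (suc zero))) ∷ rest (parallel (triangle edge₀))
  ; p<q = s<s z<s
  ; sorted = z<s ∷ sorted (parallel (triangle edge₀))
  ; uniq = ((λ ()) ∷ AllPairs.head u₄) ∷ ((λ ()) ∷ (λ ()) ∷ (λ ()) ∷ (λ ()) ∷ []) ∷ AllPairs.tail u₄
  }
  where u₄ = uniq (parallel (triangle edge₀))

vec-K₄ : vec K₄ ≡ (8 , 8)
vec-K₄ = refl

-- Straight-line drawings

Affine : Set
Affine = ℚ × ℚ × ℚ

_⟨_⟩ : Affine → Point → ℚ
(a , b , c) ⟨ x , y ⟩ = a ℚ.* x ℚ.+ b ℚ.* y ℚ.+ c

-- The sign conditions and OnSegment are wrapped in records so that their
-- arguments remain inferable.
record Pos (g : Affine) (a : Point) : Set where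
  constructor mkPos
  field value : 0ℚ ℚ.< g ⟨ a ⟩

record NonNeg (g : Affine) (a : Point) : Set where
  constructor mkNonNeg
  field value : 0ℚ ℚ.≤ g ⟨ a ⟩

record NonPos (g : Affine) (a : Point) : Set where
  constructor mkNonPos
  field value : g ⟨ a ⟩ ℚ.≤ 0ℚ

record Between (r a b : Point) : Set where
  constructor between
  field onSegment : OnSegment r a b

≤⇒≯ : ∀ {x y} → x ℚ.≤ y → ¬ y ℚ.< x
≤⇒≯ x≤y y<x = ℚ.<-irrefl refl (ℚ.≤-<-trans x≤y y<x)

NonPos⇒¬Pos : ∀ {g a} → NonPos g a → ¬ Pos g a
NonPos⇒¬Pos (mkNonPos ≤0) (mkPos 0<) = ≤⇒≯ ≤0 0<

-- An affine function is interpolated linearly along a segment, so signs at the ends control signs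
-- in between.
segment-value : ∀ g {r a b} ((s , _) : OnSegment r a b) →
                g ⟨ r ⟩ ≡ (1ℚ ℚ.- s) ℚ.* g ⟨ a ⟩ ℚ.+ s ℚ.* g ⟨ b ⟩
segment-value (α , β , γ) {r₁ , r₂} {a₁ , a₂} {b₁ , b₂} (s , _ , _ , refl , refl) =
  solve 8 (λ α β γ s a₁ a₂ b₁ b₂ →
      α :* (a₁ :+ s :* (b₁ :- a₁)) :+ β :* (a₂ :+ s :* (b₂ :- a₂)) :+ γ
      := (con 1ℚ :- s) :* (α :* a₁ :+ β :* a₂ :+ γ) :+ s :* (α :* b₁ :+ β :* b₂ :+ γ))
    refl α β γ s a₁ a₂ b₁ b₂
  where open +-*-Solver

*-nonNeg : ∀ {x y} → 0ℚ ℚ.≤ x → 0ℚ ℚ.≤ y → 0ℚ ℚ.≤ x ℚ.* y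
*-nonNeg {x} {y} 0≤x 0≤y = subst (ℚ._≤ x ℚ.* y) (ℚ.*-zeroʳ x)
  (ℚ.*-monoˡ-≤-nonNeg x {{ℚ.nonNegative 0≤x}} 0≤y)

*-nonPos : ∀ {x y} → 0ℚ ℚ.≤ x → y ℚ.≤ 0ℚ → x ℚ.* y ℚ.≤ 0ℚ
*-nonPos {x} {y} 0≤x y≤0 = subst (x ℚ.* y ℚ.≤_) (ℚ.*-zeroʳ x)
  (ℚ.*-monoˡ-≤-nonNeg x {{ℚ.nonNegative 0≤x}} y≤0)

*-pos : ∀ {x y} → 0ℚ ℚ.< x → 0ℚ ℚ.< y → 0ℚ ℚ.< x ℚ.* y
*-pos {x} {y} 0<x 0<y = subst (ℚ._< x ℚ.* y) (ℚ.*-zeroʳ x)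
  (ℚ.*-monoʳ-<-pos x {{ℚ.positive 0<x}} 0<y)

0≤1-s : ∀ {s} → s ℚ.≤ 1ℚ → 0ℚ ℚ.≤ 1ℚ ℚ.- s
0≤1-s {s} s≤1 = subst (ℚ._≤ 1ℚ ℚ.- s) (ℚ.+-inverseʳ s) (ℚ.+-monoˡ-≤ (ℚ.- s) s≤1)

segment-nonPos : ∀ g {r a b} → NonPos g a → NonPos g b → Between r a b → NonPos g r
segment-nonPos g {r} {a} {b} (mkNonPos a≤0) (mkNonPos b≤0) (between r∈@(s , 0≤s , s≤1 , _)) =
  mkNonPos (subst (ℚ._≤ 0ℚ) (sym (segment-value g {r} {a} {b} r∈))
    (ℚ.+-mono-≤ (*-nonPos (0≤1-s s≤1) a≤0) (*-nonPos 0≤s b≤0)))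

Between-sym : ∀ {r a b} → Between r a b → Between r b a
Between-sym {r₁ , r₂} {a₁ , a₂} {b₁ , b₂} (between (s , 0≤s , s≤1 , refl , refl)) =
  between (1ℚ ℚ.- s , 0≤1-s s≤1 , 1-s≤1 , flip a₁ b₁ , flip a₂ b₂)
  where
    open +-*-Solver
    1-s≤1 : 1ℚ ℚ.- s ℚ.≤ 1ℚ
    1-s≤1 = subst (1ℚ ℚ.- s ℚ.≤_) (ℚ.+-identityʳ 1ℚ) (ℚ.+-monoʳ-≤ 1ℚ (ℚ.neg-antimono-≤ 0≤s))
    flip : ∀ x y → x ℚ.+ s ℚ.* (y ℚ.- x) ≡ y ℚ.+ (1ℚ ℚ.- s) ℚ.* (x ℚ.- y)
    flip = solve 3 (λ s x y → x :+ s :* (y :- x) := y :+ (con 1ℚ :- s) :* (x :- y)) refl s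

-- For a positive parameter the value of `g` is positive, so the parameter is 0. All separation
-- arguments below rest on this: one segment lies where `g` is nonpositive, and the other can touch
-- that region only at its tip.
start-tip : ∀ g {r a b} → NonNeg g a → Pos g b → Between r a b → NonPos g r → r ≡ a
start-tip g {r} {a} {b} (mkNonNeg 0≤a) (mkPos 0<b) (between r∈@(s , 0≤s , s≤1 , r₁≡ , r₂≡)) (mkNonPos r≤0)
  with ℚ.<-cmp 0ℚ s
... | tri< 0<s _ _ = contradiction
  (subst (0ℚ ℚ.<_) (sym (segment-value g {r} {a} {b} r∈))
    (ℚ.+-mono-≤-< (*-nonNeg (0≤1-s s≤1) 0≤a) (*-pos 0<s 0<b)))
  (≤⇒≯ r≤0)
... | tri≈ _ refl _ = cong₂ _,_ (trans r₁≡ (at-start (proj₁ a) (proj₁ b))) (trans r₂≡ (at-start (proj₂ a) (proj₂ b)))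
  where
    at-start : ∀ x y → x ℚ.+ 0ℚ ℚ.* (y ℚ.- x) ≡ x
    at-start x y = trans (cong (x ℚ.+_) (ℚ.*-zeroˡ (y ℚ.- x))) (ℚ.+-identityʳ x)
... | tri> _ _ s<0 = contradiction s<0 (≤⇒≯ 0≤s)

end-tip : ∀ g {r a b} → Pos g a → NonNeg g b → Between r a b → NonPos g r → r ≡ b
end-tip g 0<a 0≤b r∈ = start-tip g 0≤b 0<a (Between-sym r∈)

record Drawing (es : Edges (Fin k)) (pos : Fin k → Point) : Set where
  field
    injective : ∀ {v w} → pos v ≡ pos w → v ≡ w
    avoids    : ∀ {x y} → (x , y) ∈ es → (w : Fin k) → w ≢ x → w ≢ y →
                ¬ Between (pos w) (pos x) (pos y)
    crosses   : ∀ {x y x' y'} → (x , y) ∈ es → (x' , y') ∈ es → (x , y) ≢ (x' , y') →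
                (r : Point) → Between r (pos x) (pos y) → Between r (pos x') (pos y') →
                Σ (Fin k) λ w → ((w ≡ x) ⊎ (w ≡ y)) × ((w ≡ x') ⊎ (w ≡ y')) × (r ≡ pos w)

open Drawing

Drawing-⊆ : {es es' : Edges (Fin k)} {pos : Fin k → Point} → es ⊆ es' → Drawing es' pos → Drawing es pos
Drawing-⊆ es⊆es' D = record
  { injective = injective D
  ; avoids    = avoids D ∘ es⊆es'
  ; crosses   = λ e∈ f∈ → crosses D (es⊆es' e∈) (es⊆es' f∈)
  }

extend : Point → (Fin k → Point) → Fin (suc k) → Point
extend z pos zero    = z
extend z pos (suc v) = pos v

spoke : Fin k → Fin (suc k) × Fin (suc k)
spoke n = zero , suc n

module _ {es : Edges (Fin k)} {pos : Fin k → Point} (D : Drawing es pos) (z : Point) where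

  record Spoke (n : Fin k) : Set where
    field
      vertices : ∀ w → Between (pos w) z (pos n) → pos w ≡ pos n
      edges    : ∀ {x y} → (x , y) ∈ es → ∀ {r} → Between r z (pos n) → Between r (pos x) (pos y) → r ≡ pos n

  open Spoke

  Apart : Fin k → Fin k → Set
  Apart n n' = ∀ {r} → Between r z (pos n) → Between r z (pos n') → r ≡ z

  -- Two spokes meet only at `z`. A spoke meets an old edge only at the spoke's old end, and then
  -- `avoids D` forces this vertex to be an end of the old edge.
  add-vertex : (N : List (Fin k)) → (∀ v → z ≢ pos v) →
               (∀ {x y} → (x , y) ∈ es → ¬ Between z (pos x) (pos y)) →
               All Spoke N → AllPairs Apart N → Drawing (map spoke N ++ shift es) (extend z pos)
  add-vertex N fresh off spokes apart = record { injective = injective' ; avoids = avoids' ; crosses = crosses' }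
    where
      pos' = extend z pos
      es' = map spoke N ++ shift es

      injective' : ∀ {v w} → pos' v ≡ pos' w → v ≡ w
      injective' {zero}  {zero}  eq = refl
      injective' {zero}  {suc w} eq = contradiction eq (fresh w)
      injective' {suc v} {zero}  eq = contradiction (sym eq) (fresh v)
      injective' {suc v} {suc w} eq = cong suc (injective D eq)

      data Kind : Fin (suc k) × Fin (suc k) → Set where
        new : ∀ {n} → n ∈ N → Kind (spoke n)
        old : ∀ {x y} → (x , y) ∈ es → Kind (suc x , suc y)

      kind : ∀ {e} → e ∈ es' → Kind e
      kind e∈ with ∈-++⁻ (map spoke N) e∈
      ... | inj₁ s∈ with n , n∈ , refl ← ∈-map⁻ spoke s∈ = new n∈
      ... | inj₂ o∈ with _ , xy∈ , refl ← ∈-map⁻ _ o∈ = old xy∈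

      avoids' : ∀ {x y} → (x , y) ∈ es' → ∀ w → w ≢ x → w ≢ y → ¬ Between (pos' w) (pos' x) (pos' y)
      avoids' e∈ w w≢x w≢y on with kind e∈
      avoids' e∈ zero    w≢x w≢y on | new n∈  = w≢x refl
      avoids' e∈ (suc w) w≢x w≢y on | new n∈  = w≢y (cong suc (injective D (vertices (All.lookup spokes n∈) w on)))
      avoids' e∈ zero    w≢x w≢y on | old xy∈ = off xy∈ on
      avoids' e∈ (suc w) w≢x w≢y on | old xy∈ = avoids D xy∈ w (w≢x ∘ cong suc) (w≢y ∘ cong suc) on

      apart-∈ : ∀ {M n n'} → AllPairs Apart M → n ∈ M → n' ∈ M → n ≢ n' → Apart n n'
      apart-∈ (a ∷ as) (here refl) (here refl) n≢n' = contradiction refl n≢n'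
      apart-∈ (a ∷ as) (here refl) (there n'∈) _    = All.lookup a n'∈
      apart-∈ (a ∷ as) (there n∈)  (here refl) _    = λ r∈ r∈' → All.lookup a n∈ r∈' r∈
      apart-∈ (a ∷ as) (there n∈)  (there n'∈) n≢n' = apart-∈ as n∈ n'∈ n≢n'

      touch : ∀ {n x y r} → n ∈ N → (x , y) ∈ es → Between r z (pos n) → Between r (pos x) (pos y) →
              (suc n ≡ suc x ⊎ suc n ≡ suc y) × r ≡ pos n
      touch {n} {x} {y} n∈ xy∈ r∈ r∈' with edges (All.lookup spokes n∈) xy∈ r∈ r∈'
      ... | refl with n Fin.≟ x | n Fin.≟ y
      ...   | yes n≡x | _       = inj₁ (cong suc n≡x) , refl
      ...   | no _    | yes n≡y = inj₂ (cong suc n≡y) , refl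
      ...   | no n≢x  | no n≢y  = contradiction r∈' (avoids D xy∈ n n≢x n≢y)

      crosses' : ∀ {x y x' y'} → (x , y) ∈ es' → (x' , y') ∈ es' → (x , y) ≢ (x' , y') →
                 (r : Point) → Between r (pos' x) (pos' y) → Between r (pos' x') (pos' y') →
                 Σ (Fin (suc k)) λ w → ((w ≡ x) ⊎ (w ≡ y)) × ((w ≡ x') ⊎ (w ≡ y')) × (r ≡ pos' w)
      crosses' e∈ f∈ e≢f r r∈ r∈' with kind e∈ | kind f∈
      ... | new n∈ | new n'∈ =
        zero , inj₁ refl , inj₁ refl , apart-∈ apart n∈ n'∈ (λ { refl → e≢f refl }) r∈ r∈'
      ... | new {n} n∈ | old xy∈ =
        let end , r≡ = touch n∈ xy∈ r∈ r∈' in suc n , inj₂ refl , end , r≡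
      ... | old xy∈ | new {n} n∈ =
        let end , r≡ = touch n∈ xy∈ r∈' r∈ in suc n , end , inj₂ refl , r≡
      ... | old xy∈ | old xy'∈ =
        let w , end , end' , r≡ = crosses D xy∈ xy'∈ (λ { refl → e≢f refl }) r r∈ r∈'
        in suc w , suc-end end , suc-end end' , r≡
        where
          suc-end : ∀ {w a b : Fin k} → w ≡ a ⊎ w ≡ b → suc w ≡ suc a ⊎ suc w ≡ suc b
          suc-end (inj₁ eq) = inj₁ (cong suc eq)
          suc-end (inj₂ eq) = inj₂ (cong suc eq)

-- Placing new vertices beside the distinguished edge.

3ℚ : ℚ
3ℚ = ℤ.+ 3 ℚ./ 1

-- Carries a new vertex (−3 , 0) to the origin O and O to H, hence the new
-- distinguished edge to the position of the old one.
turn : Point → Point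
turn (x , y) = y , x ℚ.+ 3ℚ

turn⁻¹ : Point → Point
turn⁻¹ (x , y) = y ℚ.- 3ℚ , x

turn-turn⁻¹ : ∀ r → turn (turn⁻¹ r) ≡ r
turn-turn⁻¹ (x , y) = cong (x ,_) (solve 1 (λ y → (y :- con 3ℚ) :+ con 3ℚ := y) refl y)
  where open +-*-Solver

turn⁻¹-turn : ∀ r → turn⁻¹ (turn r) ≡ r
turn⁻¹-turn (x , y) = cong (_, y) (solve 1 (λ x → (x :+ con 3ℚ) :- con 3ℚ := x) refl x)
  where open +-*-Solver

Between-turn⁻¹ : ∀ {r} a b → Between r (turn a) (turn b) → Between (turn⁻¹ r) a b
Between-turn⁻¹ {r₁ , r₂} (a₁ , a₂) (b₁ , b₂) (between (s , 0≤s , s≤1 , refl , refl)) = between (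
  s , 0≤s , s≤1 ,
  solve 3 (λ s a b → ((a :+ con 3ℚ) :+ s :* ((b :+ con 3ℚ) :- (a :+ con 3ℚ))) :- con 3ℚ
                     := a :+ s :* (b :- a)) refl s a₁ b₁ ,
  refl)
  where open +-*-Solver

Drawing-turn : {es : Edges (Fin k)} {pos : Fin k → Point} → Drawing es pos → Drawing es (turn ∘ pos)
Drawing-turn {pos = pos} D = record
  { injective = λ eq → injective D (trans (sym (turn⁻¹-turn _)) (trans (cong turn⁻¹ eq) (turn⁻¹-turn _)))
  ; avoids    = λ {x} {y} e∈ w w≢x w≢y on → avoids D e∈ w w≢x w≢y
      (subst (λ a → Between a (pos x) (pos y)) (turn⁻¹-turn (pos w)) (Between-turn⁻¹ (pos x) (pos y) on))
  ; crosses   = λ {x} {y} {x'} {y'} e∈ f∈ e≢f r r∈ r∈' →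
      let w , end , end' , r≡ = crosses D e∈ f∈ e≢f (turn⁻¹ r)
            (Between-turn⁻¹ (pos x) (pos y) r∈) (Between-turn⁻¹ (pos x') (pos y') r∈')
      in w , end , end' , trans (sym (turn-turn⁻¹ r)) (cong turn r≡)
  }

-1ℚ -3ℚ : ℚ
-1ℚ = ℤ.-[1+ 0 ] ℚ./ 1
-3ℚ = ℤ.-[1+ 2 ] ℚ./ 1

-- The distinguished edge is OH; Z₁ is placed outside the drawing and Z₂ inside
-- the triangle O H Z₁.
O H Z₁ Z₂ : Point
O = 0ℚ , 0ℚ
H = 0ℚ , 3ℚ
Z₁ = -3ℚ , 0ℚ
Z₂ = -1ℚ , 1ℚ

record Layout (es : Edges (Fin k)) (p q : Fin k) : Set where
  field
    pos      : Fin k → Point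
    drawing  : Drawing es pos
    pos-p    : pos p ≡ O
    pos-q    : pos q ≡ H
    quadrant : ∀ v → 0ℚ ℚ.≤ proj₁ (pos v) × 0ℚ ℚ.≤ proj₂ (pos v)

open Layout

-- The separating lines: `west` is -x, `north` is y, and `roof` is x - y + 3, zero on the line
-- through `Z₁` and `H` and positive below it. `east⁺` and `north⁻` vanish on the vertical and the
-- horizontal through `Z₂`.
west north roof east⁺ north⁻ : Affine
west   = -1ℚ , 0ℚ , 0ℚ
north  = 0ℚ , 1ℚ , 0ℚ
roof   = 1ℚ , -1ℚ , 3ℚ
east⁺  = 1ℚ , 0ℚ , 1ℚ
north⁻ = 0ℚ , 1ℚ , -1ℚ

pos? : ∀ g a → Dec (Pos g a)
pos? g a = map′ mkPos Pos.value (0ℚ ℚ.<? g ⟨ a ⟩)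

nonNeg? : ∀ g a → Dec (NonNeg g a)
nonNeg? g a = map′ mkNonNeg NonNeg.value (0ℚ ℚ.≤? g ⟨ a ⟩)

nonPos? : ∀ g a → Dec (NonPos g a)
nonPos? g a = map′ mkNonPos NonPos.value (g ⟨ a ⟩ ℚ.≤? 0ℚ)

at : {P : Point → Set} (P? : ∀ a → Dec (P a)) {a b : Point} → b ≡ a → True (P? a) → P b
at P? refl = toWitness

west-nonPos : ∀ a → 0ℚ ℚ.≤ proj₁ a → NonPos west a
west-nonPos (x , y) 0≤x = mkNonPos (subst (ℚ._≤ 0ℚ)
  (solve 2 (λ x y → :- x := con -1ℚ :* x :+ con 0ℚ :* y :+ con 0ℚ) refl x y)
  (ℚ.neg-antimono-≤ 0≤x))
  where open +-*-Solver

module _ {es : Edges (Fin k)} {p q : Fin k} (L : Layout es p q) where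

  private
    vertex-west : ∀ v → NonPos west (pos L v)
    vertex-west v = west-nonPos (pos L v) (proj₁ (quadrant L v))

    edge-west : ∀ x y {r} → Between r (pos L x) (pos L y) → NonPos west r
    edge-west x y = segment-nonPos west (vertex-west x) (vertex-west y)

    es₁ : Edges (Fin (suc k))
    es₁ = spoke p ∷ spoke q ∷ shift es

    pos₁ : Fin (suc k) → Point
    pos₁ = extend Z₁ (pos L)

    -- `Z₂` is joined to all three corners of the triangle, so that every two-vertex extension
    -- required later, `K₄` included, is a subgraph.
    es₂ : Edges (Fin (suc (suc k)))
    es₂ = spoke zero ∷ spoke (suc p) ∷ spoke (suc q) ∷ shift es₁

    pos₂ : Fin (suc (suc k)) → Point
    pos₂ = extend Z₂ pos₁

    spoke₁ : ∀ n → NonNeg west (pos L n) → Spoke (drawing L) Z₁ n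
    spoke₁ n 0≤n = record
      { vertices = λ w on → end-tip west (at (pos? west) refl _) 0≤n on (vertex-west w)
      ; edges    = λ {x} {y} xy∈ r∈ r∈' → end-tip west (at (pos? west) refl _) 0≤n r∈ (edge-west x y r∈')
      }

    outer : Drawing es₁ pos₁
    outer = add-vertex (drawing L) Z₁ (p ∷ q ∷ [])
      (λ v eq → contradiction (subst (Pos west) eq (at (pos? west) refl _)) (NonPos⇒¬Pos (vertex-west v)))
      (λ {x} {y} _ on → contradiction (at (pos? west) {Z₁} refl _) (NonPos⇒¬Pos (edge-west x y on)))
      (spoke₁ p (at (nonNeg? west) (pos-p L) _) ∷ spoke₁ q (at (nonNeg? west) (pos-q L) _) ∷ [])
      -- The spoke to `p` runs along y = 0, and the spoke to `q` rises from this line at `Z₁`.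
      (((λ r∈ r∈' → start-tip north (at (nonNeg? north) refl _) (at (pos? north) (pos-q L) _) r∈'
          (segment-nonPos north (at (nonPos? north) refl _) (at (nonPos? north) (pos-p L) _) r∈)) ∷ [])
        ∷ [] ∷ [])

    Z₁p : ∀ {r} → Between r Z₁ (pos L p) → NonPos north r
    Z₁p = segment-nonPos north (at (nonPos? north) refl _) (at (nonPos? north) (pos-p L) _)

    Z₁q : ∀ {r} → Between r Z₁ (pos L q) → NonPos roof r
    Z₁q = segment-nonPos roof (at (nonPos? roof) refl _) (at (nonPos? roof) (pos-q L) _)

    -- Every earlier edge lies in a closed half-plane that misses Z₂, and every
    -- neighbour of Z₂ in the complementary closed half-plane.
    off₂ : ∀ {x y} → (x , y) ∈ es₁ → ¬ Between Z₂ (pos₁ x) (pos₁ y)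
    off₂ (here refl)         on = contradiction (at (pos? north) {Z₂} refl _) (NonPos⇒¬Pos (Z₁p on))
    off₂ (there (here refl)) on = contradiction (at (pos? roof) {Z₂} refl _) (NonPos⇒¬Pos (Z₁q on))
    off₂ (there (there e∈))  on with (x , y) , _ , refl ← ∈-map⁻ _ e∈ =
      contradiction (at (pos? west) {Z₂} refl _) (NonPos⇒¬Pos (edge-west x y on))

    spoke₂ : ∀ n → NonNeg north (pos₁ n) → NonNeg roof (pos₁ n) → NonNeg west (pos₁ n) →
             (Between Z₁ Z₂ (pos₁ n) → Z₁ ≡ pos₁ n) → Spoke outer Z₂ n
    spoke₂ n 0≤north 0≤roof 0≤west apex = record { vertices = vertices' ; edges = edges' }
      where
        vertices' : ∀ w → Between (pos₁ w) Z₂ (pos₁ n) → pos₁ w ≡ pos₁ n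
        -- `Z₁` is the one earlier vertex on the positive side of `west`, so it needs an argument of
        -- its own.
        vertices' zero    on = apex on
        vertices' (suc w) on = end-tip west (at (pos? west) refl _) 0≤west on (vertex-west w)
        edges' : ∀ {x y} → (x , y) ∈ es₁ → ∀ {r} → Between r Z₂ (pos₁ n) → Between r (pos₁ x) (pos₁ y) →
                 r ≡ pos₁ n
        edges' (here refl)         r∈ r∈' = end-tip north (at (pos? north) refl _) 0≤north r∈ (Z₁p r∈')
        edges' (there (here refl)) r∈ r∈' = end-tip roof (at (pos? roof) refl _) 0≤roof r∈ (Z₁q r∈')
        edges' (there (there e∈))  r∈ r∈' with (x , y) , _ , refl ← ∈-map⁻ _ e∈ =
          end-tip west (at (pos? west) refl _) 0≤west r∈ (edge-west x y r∈')

    inner : Drawing es₂ pos₂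
    inner = add-vertex outer Z₂ (zero ∷ suc p ∷ suc q ∷ []) fresh off₂
      ( spoke₂ zero (at (nonNeg? north) refl _) (at (nonNeg? roof) refl _) (at (nonNeg? west) refl _) (λ _ → refl)
      ∷ spoke₂ (suc p) (at (nonNeg? north) (pos-p L) _) (at (nonNeg? roof) (pos-p L) _) (at (nonNeg? west) (pos-p L) _)
          (λ on → end-tip north (at (pos? north) refl _) (at (nonNeg? north) (pos-p L) _) on (at (nonPos? north) refl _))
      ∷ spoke₂ (suc q) (at (nonNeg? north) (pos-q L) _) (at (nonNeg? roof) (pos-q L) _) (at (nonNeg? west) (pos-q L) _)
          (λ on → end-tip roof (at (pos? roof) refl _) (at (nonNeg? roof) (pos-q L) _) on (at (nonPos? roof) refl _))
      ∷ [])
      -- The vertical through `Z₂` separates the spoke to `Z₁` from the other two, which the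
      -- horizontal through `Z₂` separates from each other.
      ( ( apart east⁺ (at (nonNeg? east⁺) refl _) (at (nonPos? east⁺) refl _)
            (at (nonPos? east⁺) refl _) (at (pos? east⁺) (pos-p L) _)
        ∷ apart east⁺ (at (nonNeg? east⁺) refl _) (at (nonPos? east⁺) refl _)
            (at (nonPos? east⁺) refl _) (at (pos? east⁺) (pos-q L) _)
        ∷ [])
      ∷ ( apart north⁻ (at (nonNeg? north⁻) refl _) (at (nonPos? north⁻) refl _)
            (at (nonPos? north⁻) (pos-p L) _) (at (pos? north⁻) (pos-q L) _)
        ∷ [])
      ∷ [] ∷ [])
      where
        fresh : ∀ v → Z₂ ≢ pos₁ v
        fresh zero    ()
        fresh (suc v) eq = contradiction (subst (Pos west) eq (at (pos? west) refl _)) (NonPos⇒¬Pos (vertex-west v))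
        apart : ∀ g {z a b} → NonNeg g z → NonPos g z → NonPos g a → Pos g b →
                ∀ {r} → Between r z a → Between r z b → r ≡ z
        apart g 0≤z z≤0 a≤0 0<b r∈a r∈b = start-tip g 0≤z 0<b r∈b (segment-nonPos g z≤0 a≤0 r∈a)

    turn-quadrant : ∀ a → -3ℚ ℚ.≤ proj₁ a → 0ℚ ℚ.≤ proj₂ a →
                    0ℚ ℚ.≤ proj₁ (turn a) × 0ℚ ℚ.≤ proj₂ (turn a)
    turn-quadrant a -3≤x 0≤y = 0≤y , ℚ.+-monoˡ-≤ 3ℚ -3≤x

    quadrant₁ : ∀ v → 0ℚ ℚ.≤ proj₁ (turn (pos₁ v)) × 0ℚ ℚ.≤ proj₂ (turn (pos₁ v))
    quadrant₁ zero    = turn-quadrant Z₁ ℚ.≤-refl ℚ.≤-refl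
    quadrant₁ (suc v) = let 0≤x , 0≤y = quadrant L v in
      turn-quadrant (pos L v) (ℚ.≤-trans (toWitness {a? = -3ℚ ℚ.≤? 0ℚ} _) 0≤x) 0≤y

    quadrant₂ : ∀ v → 0ℚ ℚ.≤ proj₁ (turn (pos₂ v)) × 0ℚ ℚ.≤ proj₂ (turn (pos₂ v))
    quadrant₂ zero    = turn-quadrant Z₂ (toWitness {a? = -3ℚ ℚ.≤? -1ℚ} _) (toWitness {a? = 0ℚ ℚ.≤? 1ℚ} _)
    quadrant₂ (suc v) = quadrant₁ v

  Layout-outer : Layout es₁ zero (suc p)
  Layout-outer = record
    { pos = turn ∘ pos₁ ; drawing = Drawing-turn outer ; pos-p = refl ; pos-q = cong turn (pos-p L)
    ; quadrant = quadrant₁ }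

  Layout-inner : Layout es₂ (suc zero) (suc (suc p))
  Layout-inner = record
    { pos = turn ∘ pos₂ ; drawing = Drawing-turn inner ; pos-p = refl ; pos-q = cong turn (pos-p L)
    ; quadrant = quadrant₂ }

Layout-⊆ : {es es' : Edges (Fin k)} {p q : Fin k} → es ⊆ es' → Layout es' p q → Layout es p q
Layout-⊆ es⊆es' L = record
  { pos = pos L ; drawing = Drawing-⊆ es⊆es' (drawing L) ; pos-p = pos-p L ; pos-q = pos-q L ; quadrant = quadrant L }

Drawn : Frame n → Set
Drawn F = Layout (full F) (p F) (q F)

planar : {F : Frame n} → Drawn F → Planar (graph F)
planar L = record
  { pos = pos L ; injective = injective (drawing L)
  ; avoidVertices = λ e∈ w w≢x w≢y → avoids (drawing L) e∈ w w≢x w≢y ∘ between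
  ; noCrossings = λ e∈ f∈ e≢f r r∈ r∈' → crosses (drawing L) e∈ f∈ e≢f r (between r∈) (between r∈') }

-- The vectors

drawn-edge : Drawn edge₀
drawn-edge = record
  { pos = pos' ; pos-p = refl ; pos-q = refl
  ; quadrant = λ { zero → ℚ.≤-refl , ℚ.≤-refl ; (suc zero) → ℚ.≤-refl , toWitness {a? = 0ℚ ℚ.≤? 3ℚ} _ }
  ; drawing = record { injective = λ {v} {w} → injective' v w ; avoids = avoids' ; crosses = crosses' }
  }
  where
    pos' : Fin 2 → Point
    pos' zero       = O
    pos' (suc zero) = H
    injective' : ∀ v w → pos' v ≡ pos' w → v ≡ w
    injective' zero       zero       _ = refl
    injective' zero       (suc zero) ()
    injective' (suc zero) zero       ()
    injective' (suc zero) (suc zero) _ = refl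
    avoids' : ∀ {x y} → (x , y) ∈ full edge₀ → ∀ w → w ≢ x → w ≢ y → ¬ Between (pos' w) (pos' x) (pos' y)
    avoids' (here refl) zero       w≢x w≢y = contradiction refl w≢x
    avoids' (here refl) (suc zero) w≢x w≢y = contradiction refl w≢y
    crosses' : ∀ {x y x' y'} → (x , y) ∈ full edge₀ → (x' , y') ∈ full edge₀ → (x , y) ≢ (x' , y') → _
    crosses' (here refl) (here refl) e≢f = contradiction refl e≢f

drawn-triangle : (F : Frame n) → Drawn F → Drawn (triangle F)
drawn-triangle F = Layout-outer {es = full F}

drawn-subdivide : (F : Frame n) → Drawn F → Drawn (subdivide F)
drawn-subdivide F = Layout-⊆ (λ
  { (here eq)          → here eq
  ; (there (here eq))  → there (here eq)
  ; (there (there e∈)) → there (there (there e∈))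
  }) ∘ drawn-triangle F

drawn-parallel-triangle : (F : Frame n) → Drawn F → Drawn (parallel (triangle F))
drawn-parallel-triangle F = Layout-⊆ (λ
  { (here eq)                  → there (there (there (here eq)))
  ; (there (here eq))          → here eq
  ; (there (there (here eq)))  → there (here eq)
  ; (there (there (there e∈))) → there (there (there (there e∈)))
  }) ∘ Layout-inner {es = full F}

drawn-parallel-subdivide : (F : Frame n) → Drawn F → Drawn (parallel (subdivide F))
drawn-parallel-subdivide F = Layout-⊆ (λ
  { (here eq)                          → here eq
  ; (there (here eq))                  → there (here eq)
  ; (there (there (here eq)))          → there (there (here eq))
  ; (there (there (there (here eq))))  → there (there (there (here eq)))
  ; (there (there (there (there e∈)))) → there (there (there (there (there e∈))))
  }) ∘ drawn-parallel-triangle F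

drawn-K₄ : Drawn K₄
drawn-K₄ = Layout-⊆ (λ
  { (here eq)                          → there (there (there (here eq)))
  ; (there (here eq))                  → there (there (here eq))
  ; (there (there (here eq)))          → here eq
  ; (there (there (there (here eq))))  → there (here eq)
  ; (there (there (there (there e∈)))) → there (there (there (there e∈)))
  }) (Layout-inner drawn-edge)

-- Realizing the vectors level by level.

Realizable : ℕ → ℕ × ℕ → Set
Realizable n v = Σ (Frame n) λ F → Drawn F × vec F ≡ v

feasible : ∀ {v} → Realizable n v → PlanarFeasible (n + 2) v
feasible {n} (F , D , refl) =
  suc n , ℕ.≤-reflexive (ℕ.+-comm 2 n) , graph F , planar D , zero , refl , refl

Aᵛ Bᵛ Cᵛ Eᵛ : ℕ × ℕ → ℕ × ℕ
Aᵛ = subdivideᵛ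
Bᵛ = triangleᵛ
Cᵛ = parallelᵛ ∘ subdivideᵛ
Eᵛ = triangleᵛ ∘ parallelᵛ ∘ triangleᵛ

realize-A : ∀ {v} → Realizable n v → Realizable (1 + n) (Aᵛ v)
realize-A (F , D , refl) = subdivide F , drawn-subdivide F D , vec-subdivide F

realize-B : ∀ {v} → Realizable n v → Realizable (1 + n) (Bᵛ v)
realize-B (F , D , refl) = triangle F , drawn-triangle F D , vec-triangle F

realize-C : ∀ {v} → Realizable n v → Realizable (2 + n) (Cᵛ v)
realize-C (F , D , refl) = parallel (subdivide F) , drawn-parallel-subdivide F D ,
  trans (vec-parallel (subdivide F)) (cong parallelᵛ (vec-subdivide F))

realize-E : ∀ {v} → Realizable n v → Realizable (3 + n) (Eᵛ v)
realize-E (F , D , refl) = realize-B (parallel (triangle F) , drawn-parallel-triangle F D ,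
  trans (vec-parallel (triangle F)) (cong parallelᵛ (vec-triangle F)))

-- L n lists the vectors obtained with n + 2 vertices, and M n those of
-- L (suc n) outside the image of A.
L M : ℕ → List (ℕ × ℕ)
L zero    = (1 , 0) ∷ []
L (suc n) = map Aᵛ (L n) ++ M n
M zero          = map Bᵛ (L zero)
M (suc zero)    = map Bᵛ (L (suc zero)) ++ (8 , 8) ∷ []
M (suc (suc n)) = map Bᵛ (L (suc (suc n))) ++ map Cᵛ (M n) ++ map Eᵛ (L n)

realizable-L : ∀ n → All (Realizable n) (L n)
realizable-M : ∀ n → All (Realizable (1 + n)) (M n)
realizable-L zero    = (edge₀ , drawn-edge , vec-edge) ∷ []
realizable-L (suc n) = All.++⁺ (All.map⁺ (All.map realize-A (realizable-L n))) (realizable-M n)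
realizable-M zero          = All.map⁺ (All.map realize-B (realizable-L zero))
realizable-M (suc zero)    = All.++⁺ (All.map⁺ (All.map realize-B (realizable-L (suc zero)))) ((K₄ , drawn-K₄ , vec-K₄) ∷ [])
realizable-M (suc (suc n)) = All.++⁺ (All.map⁺ (All.map realize-B (realizable-L (suc (suc n)))))
  (All.++⁺ (All.map⁺ (All.map realize-C (realizable-M n))) (All.map⁺ (All.map realize-E (realizable-L n))))

-- Ratio bounds on the vectors.

-- Ratio 1 arises only from `(8 , 8)` and its images under `Cᵛ`, which maps `(d , d)` to
-- `(4d , 4d)`. The bound 8 survives this and excludes `(1 , 1)` and `(4 , 4)`.
Proper : ℕ × ℕ → Set
Proper (t , u) = 0 < u × (u < t ⊎ (u ≡ t × 8 ≤ t))

Good : ℕ × ℕ → Set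
Good v = v ≡ (1 , 0) ⊎ Proper v

-- Ratio below 2, except for the triangle's vector `(2 , 1)`, the image of `(1 , 0)` under `Bᵛ`.
Flat : ℕ × ℕ → Set
Flat (t , u) = t < u + u ⊎ (t , u) ≡ (2 , 1)

Proper-≤ : ∀ {t u} → Proper (t , u) → u ≤ t
Proper-≤ (_ , inj₁ u<t)        = ℕ.<⇒≤ u<t
Proper-≤ (_ , inj₂ (refl , _)) = ℕ.≤-refl

Good-≤ : ∀ {t u} → Good (t , u) → u ≤ t
Good-≤ (inj₁ refl) = z≤n
Good-≤ (inj₂ pr)   = Proper-≤ pr

Good-pos : ∀ {t u} → Good (t , u) → 0 < t
Good-pos (inj₁ refl) = z<s
Good-pos (inj₂ pr)   = ℕ.<-≤-trans (proj₁ pr) (Proper-≤ pr)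

¬Good-diagonal : ∀ {d} → d < 8 → ¬ Good (d , d)
¬Good-diagonal d<8 (inj₁ ())
¬Good-diagonal d<8 (inj₂ (_ , inj₁ d<d))      = ℕ.<-irrefl refl d<d
¬Good-diagonal d<8 (inj₂ (_ , inj₂ (_ , 8≤d))) = ℕ.<⇒≱ d<8 8≤d

Flat-≤ : ∀ {t u} → Flat (t , u) → t ≤ u + u
Flat-≤ (inj₁ t<)   = ℕ.<⇒≤ t<
Flat-≤ (inj₂ refl) = ℕ.≤-refl

good-A : ∀ {v} → Good v → Good (Aᵛ v)
good-A (inj₁ refl) = inj₁ refl
good-A {t , u} g@(inj₂ (0<u , _)) = inj₂ (0<u , inj₁ (ℕ.m<n+m u (Good-pos g)))

proper-B : ∀ {t u} → 0 < t → Proper (Bᵛ (t , u))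
proper-B {t} {u} 0<t = ℕ.<-≤-trans 0<t (ℕ.m≤m+n t u) , inj₁ (ℕ.m<n+m (t + u) 0<t)

flat-B : ∀ {t u} → 0 < u → Flat (Bᵛ (t , u))
flat-B {t} {u} 0<u = inj₁ (ℕ.+-monoˡ-< (t + u) (ℕ.m<m+n t 0<u))

flat-B-good : ∀ {v} → Good v → Flat (Bᵛ v)
flat-B-good (inj₁ refl)      = inj₂ refl
flat-B-good (inj₂ (0<u , _)) = flat-B 0<u

proper-C : ∀ {v} → Proper v → Proper (Cᵛ v)
proper-C {t , u} pr@(0<u , cases) =
  ℕ.<-≤-trans 0<u (ℕ.m≤n+m u (t + u + u)) , side cases
  where
    rearrange : t + u + u + u ≡ (t + u) + (u + u)
    rearrange = ℕ.+-assoc (t + u) u u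
    side : u < t ⊎ (u ≡ t × 8 ≤ t) → _
    side (inj₁ u<t) = inj₁ (subst (_< (t + u) + (t + u)) (sym rearrange) (ℕ.+-monoʳ-< (t + u) (ℕ.+-monoˡ-< u u<t)))
    side (inj₂ (refl , 8≤t)) = inj₂ (rearrange , ℕ.≤-trans 8≤t (ℕ.≤-trans (ℕ.m≤m+n t t) (ℕ.m≤m+n (t + t) (t + t))))

flat-C : ∀ {v} → Proper v → Flat (Cᵛ v)
flat-C {t , u} (0<u , _) = inj₁ (ℕ.+-mono-< t+u<U t+u<U)
  where
    t+u<U : t + u < t + u + u + u
    t+u<U = ℕ.<-≤-trans (ℕ.m<m+n (t + u) 0<u) (ℕ.m≤m+n (t + u + u) u)

record Low (v : ℕ × ℕ) : Set where
  constructor low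
  field
    proper : Proper v
    flat   : Flat v

low-B : ∀ {v} → Good v → Low (Bᵛ v)
low-B g = low (proper-B (Good-pos g)) (flat-B-good g)

low-C : ∀ {v} → Low v → Low (Cᵛ v)
low-C (low pr _) = low (proper-C pr) (flat-C pr)

low-E : ∀ {v} → Good v → Low (Eᵛ v)
low-E {t , u} g = low (proper-B {u = proj₂ w} 0<fst) (flat-B {proj₁ w} 0<snd)
  where
    w = parallelᵛ (triangleᵛ (t , u))
    0<T : 0 < t + (t + u)
    0<T = ℕ.<-≤-trans (Good-pos g) (ℕ.m≤m+n t (t + u))
    0<fst : 0 < proj₁ w
    0<fst = ℕ.<-≤-trans 0<T (ℕ.m≤m+n _ (t + (t + u)))
    0<snd : 0 < proj₂ w
    0<snd = ℕ.<-≤-trans 0<T (ℕ.≤-trans (ℕ.m≤m+n _ (t + u)) (ℕ.m≤m+n _ (t + u)))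

good-L : ∀ n → All Good (L n)
low-M  : ∀ n → All Low (M n)
good-L zero    = inj₁ refl ∷ []
good-L (suc n) = All.++⁺ (All.map⁺ (All.map good-A (good-L n))) (All.map (inj₂ ∘ Low.proper) (low-M n))
low-M zero          = All.map⁺ (All.map low-B (good-L zero))
low-M (suc zero)    = All.++⁺ (All.map⁺ (All.map low-B (good-L (suc zero))))
  (low (z<s , inj₂ (refl , ℕ.≤-refl)) (inj₁ (ℕ.m<m+n 8 z<s)) ∷ [])
low-M (suc (suc n)) = All.++⁺ (All.map⁺ (All.map low-B (good-L (suc (suc n)))))
  (All.++⁺ (All.map⁺ (All.map low-C (low-M n))) (All.map⁺ (All.map low-E (good-L n))))

-- Injectivity of the maps and disjointness of their images.

double-injective : ∀ {m n} → m + m ≡ n + n → m ≡ n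
double-injective {m} {n} eq = ℕ.*-cancelˡ-≡ m n 2
  (trans (cong (m +_) (ℕ.+-identityʳ m)) (trans eq (sym (cong (n +_) (ℕ.+-identityʳ n)))))

subdivideᵛ-injective : ∀ {v w} → subdivideᵛ v ≡ subdivideᵛ w → v ≡ w
subdivideᵛ-injective {t , u} {t' , u'} eq with refl ← cong proj₂ eq =
  cong (_, u) (ℕ.+-cancelʳ-≡ u t t' (cong proj₁ eq))

triangleᵛ-injective : ∀ {v w} → triangleᵛ v ≡ triangleᵛ w → v ≡ w
triangleᵛ-injective {t , u} {t' , u'} eq
  with refl ← ℕ.+-cancelʳ-≡ (t + u) t t' (trans (cong proj₁ eq) (cong (t' +_) (sym (cong proj₂ eq)))) =
  cong (t ,_) (ℕ.+-cancelˡ-≡ t u u' (cong proj₂ eq))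

parallelᵛ-injective : ∀ {v w} → parallelᵛ v ≡ parallelᵛ w → v ≡ w
parallelᵛ-injective {t , u} {t' , u'} eq with refl ← double-injective {t} {t'} (cong proj₁ eq) =
  cong (t ,_) (double-injective (ℕ.+-cancelˡ-≡ t (u + u) (u' + u')
    (trans (sym (ℕ.+-assoc t u u)) (trans (cong proj₂ eq) (ℕ.+-assoc t u' u')))))

-- The ratio of `Aᵛ v` is at least 2, and the only flat vector of ratio 2 is `(2 , 1)`, which would
-- need `v` to be `(1 , 1)`.
A≢low : ∀ {v w} → Good v → Low w → Aᵛ v ≢ w
A≢low {t , u} g (low _ (inj₁ flat)) refl = ℕ.<⇒≱ (ℕ.+-cancelʳ-< u t u flat) (Good-≤ g)
A≢low {t , u} g (low _ (inj₂ eq)) refl = ¬Good-diagonal (s<s z<s) (subst Good (subdivideᵛ-injective {w = 1 , 1} eq) g)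

B≢K₄ : ∀ {v} → Good v → Bᵛ v ≢ (8 , 8)
B≢K₄ {t , u} g eq = ℕ.<-irrefl (trans (cong proj₂ eq) (sym (cong proj₁ eq))) (ℕ.m<n+m (t + u) (Good-pos g))

-- The two sides differ by t - u.
steep-B-3/2 : ∀ {v} → Good v → 3 * proj₂ (Bᵛ v) ≤ 2 * proj₁ (Bᵛ v)
steep-B-3/2 {t , u} g = begin
  3 * (t + u)             ≡⟨ lhs t u ⟩
  2 * (t + u) + t + u     ≤⟨ ℕ.+-monoʳ-≤ (2 * (t + u) + t) (Good-≤ g) ⟩
  2 * (t + u) + t + t     ≡⟨ rhs t u ⟩
  2 * (t + (t + u))       ∎
  where
    open ℕ.≤-Reasoning
    lhs : ∀ t u → 3 * (t + u) ≡ 2 * (t + u) + t + u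
    lhs = solve-∀
    rhs : ∀ t u → 2 * (t + u) + t + t ≡ 2 * (t + (t + u))
    rhs = solve-∀

-- The two sides differ by 4(2u - t), which flatness makes nonnegative.
flat-C-6/5 : ∀ {v} → Low v → 5 * proj₁ (Cᵛ v) ≤ 6 * proj₂ (Cᵛ v)
flat-C-6/5 {t , u} (low _ fl) = begin
  5 * ((t + u) + (t + u))           ≡⟨ lhs t u ⟩
  6 * t + 10 * u + 4 * t            ≤⟨ ℕ.+-monoʳ-≤ (6 * t + 10 * u) (ℕ.*-monoʳ-≤ 4 (Flat-≤ fl)) ⟩
  6 * t + 10 * u + 4 * (u + u)      ≡⟨ rhs t u ⟩
  6 * (t + u + u + u)               ∎
  where
    open ℕ.≤-Reasoning
    lhs : ∀ t u → 5 * ((t + u) + (t + u)) ≡ 6 * t + 10 * u + 4 * t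
    lhs = solve-∀
    rhs : ∀ t u → 6 * t + 10 * u + 4 * (u + u) ≡ 6 * (t + u + u + u)
    rhs = solve-∀

-- X + (X + Y) and X + Y are the components of Eᵛ (t , u), unfolded for the solver.
E-gap-6/5 : ∀ t u → let T = t + (t + u); U = t + u; X = T + T; Y = (T + U) + U in
            6 * (X + Y) + (t + (11 * t + 5 * u)) ≡ 5 * (X + (X + Y))
E-gap-6/5 = solve-∀

E-gap-3/2 : ∀ t u → let T = t + (t + u); U = t + u; X = T + T; Y = (T + U) + U in
            2 * (X + (X + Y)) + u ≡ 3 * (X + Y)
E-gap-3/2 = solve-∀

-- The gap is 12t + 5u; one t is split off because `Good` guarantees only that t is positive.
steep-E-6/5 : ∀ {v} → Good v → 6 * proj₂ (Eᵛ v) < 5 * proj₁ (Eᵛ v)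
steep-E-6/5 {t , u} g = subst (6 * proj₂ (Eᵛ (t , u)) <_) (E-gap-6/5 t u)
  (ℕ.m<m+n (6 * proj₂ (Eᵛ (t , u))) (ℕ.<-≤-trans (Good-pos g) (ℕ.m≤m+n t (11 * t + 5 * u))))

-- The ratio of `Cᵛ w` is strictly below 3/2: the gap 5u - t is at least 3u, hence positive.
B≢C : ∀ {v w} → Good v → Low w → Bᵛ v ≢ Cᵛ w
B≢C {v} {t , u} g lw eq = ℕ.<⇒≱ tooFlat (subst (λ x → 3 * proj₂ x ≤ 2 * proj₁ x) eq (steep-B-3/2 g))
  where
    open ℕ.≤-Reasoning
    lhs : ∀ t u → 2 * ((t + u) + (t + u)) ≡ 3 * t + 4 * u + t
    lhs = solve-∀
    rhs : ∀ t u → 3 * t + 4 * u + (u + u) + (u + u + u) ≡ 3 * (t + u + u + u)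
    rhs = solve-∀
    tooFlat : 2 * proj₁ (Cᵛ (t , u)) < 3 * proj₂ (Cᵛ (t , u))
    tooFlat = begin-strict
      2 * ((t + u) + (t + u))                      ≡⟨ lhs t u ⟩
      3 * t + 4 * u + t                            ≤⟨ ℕ.+-monoʳ-≤ (3 * t + 4 * u) (Flat-≤ (Low.flat lw)) ⟩
      3 * t + 4 * u + (u + u)                      <⟨ ℕ.m<m+n _ (ℕ.<-≤-trans (proj₁ (Low.proper lw)) (ℕ.m≤n+m u (u + u))) ⟩
      3 * t + 4 * u + (u + u) + (u + u + u)        ≡⟨ rhs t u ⟩
      3 * (t + u + u + u)                          ∎

-- `Eᵛ w` falls short of ratio 3/2 by a gap of exactly u. This vanishes only for `(1 , 0)`, whose
-- image `(12 , 8)` is that of `(4 , 4)` under `Bᵛ`.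
B≢E : ∀ {v w} → Good v → Good w → Bᵛ v ≢ Eᵛ w
B≢E {v} g (inj₁ refl) eq with refl ← triangleᵛ-injective {v} {4 , 4} eq =
  ¬Good-diagonal (s<s (s<s (s<s (s<s z<s)))) g
B≢E {v} {t , u} g (inj₂ (0<u , _)) eq = ℕ.<⇒≱
  (subst (2 * proj₁ (Eᵛ (t , u)) <_) (E-gap-3/2 t u) (ℕ.m<m+n _ 0<u))
  (subst (λ x → 3 * proj₂ x ≤ 2 * proj₁ x) eq (steep-B-3/2 g))

C≢E : ∀ {v w} → Low v → Good w → Cᵛ v ≢ Eᵛ w
C≢E lw g eq = ℕ.<⇒≱ (steep-E-6/5 g) (subst (λ x → 5 * proj₁ x ≤ 6 * proj₂ x) eq (flat-C-6/5 lw))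

disjoint-map : {A B C : Set} {f : A → C} {g : B → C} {P : A → Set} {Q : B → Set} →
               (∀ {x y} → P x → Q y → f x ≢ g y) → {xs : List A} {ys : List B} →
               All P xs → All Q ys → Disjoint (map f xs) (map g ys)
disjoint-map f≢g ps qs (v∈f , v∈g) with ∈-map⁻ _ v∈f | ∈-map⁻ _ v∈g
... | x , x∈ , refl | y , y∈ , eq = f≢g (All.lookup ps x∈) (All.lookup qs y∈) eq

disjoint-++ : {A : Set} {xs ys zs : List A} → Disjoint xs ys → Disjoint xs zs → Disjoint xs (ys ++ zs)
disjoint-++ {ys = ys} xy xz (v∈xs , v∈) with ∈-++⁻ ys v∈
... | inj₁ v∈ys = xy (v∈xs , v∈ys)
... | inj₂ v∈zs = xz (v∈xs , v∈zs)

unique-L : ∀ n → Unique (L n)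
unique-M : ∀ n → Unique (M n)
unique-L zero    = [] ∷ []
unique-L (suc n) = Unique.++⁺ (Unique.map⁺ subdivideᵛ-injective (unique-L n)) (unique-M n) disjoint
  where
    disjoint : Disjoint (map Aᵛ (L n)) (M n)
    disjoint (v∈A , v∈M) with x , x∈ , refl ← ∈-map⁻ _ v∈A =
      A≢low (All.lookup (good-L n) x∈) (All.lookup (low-M n) v∈M) refl
unique-M zero          = Unique.map⁺ triangleᵛ-injective (unique-L zero)
unique-M (suc zero)    = Unique.++⁺ (Unique.map⁺ triangleᵛ-injective (unique-L (suc zero))) ([] ∷ []) disjoint
  where
    disjoint : Disjoint (map Bᵛ (L (suc zero))) ((8 , 8) ∷ [])
    disjoint (v∈B , here refl) with x , x∈ , eq ← ∈-map⁻ Bᵛ v∈B = B≢K₄ (All.lookup (good-L (suc zero)) x∈) (sym eq)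
unique-M (suc (suc n)) = Unique.++⁺ (Unique.map⁺ triangleᵛ-injective (unique-L (suc (suc n))))
  (Unique.++⁺ (Unique.map⁺ (subdivideᵛ-injective ∘ parallelᵛ-injective) (unique-M n))
              (Unique.map⁺ (triangleᵛ-injective ∘ parallelᵛ-injective ∘ triangleᵛ-injective) (unique-L n))
              (disjoint-map C≢E (low-M n) (good-L n)))
  (disjoint-++ (disjoint-map B≢C (good-L (suc (suc n))) (low-M n)) (disjoint-map B≢E (good-L (suc (suc n))) (good-L n)))

-- Pell numbers and the bound.

pellA pellB : ℕ → ℕ
pellA j = proj₁ (pellAB j)
pellB j = proj₂ (pellAB j)

-- The two lengths are the coordinates of (1+√2)^(n+1). In `M (suc (suc n))` the `Cᵛ` and `Eᵛ` parts
-- together are as long as `L (suc n)`.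
length-L : ∀ n → length (L n) ≡ pellB (suc n)
length-M : ∀ n → length (M n) ≡ pellA (suc n)
length-L zero    = refl
length-L (suc n) = begin
  length (map Aᵛ (L n) ++ M n)           ≡⟨ length-++ (map Aᵛ (L n)) ⟩
  length (map Aᵛ (L n)) + length (M n)   ≡⟨ cong₂ _+_ (trans (length-map Aᵛ (L n)) (length-L n)) (length-M n) ⟩
  pellB (suc n) + pellA (suc n)          ≡⟨ ℕ.+-comm (pellB (suc n)) _ ⟩
  pellB (suc (suc n))                    ∎
  where open ≡-Reasoning
length-M zero          = refl
length-M (suc zero)    = refl
length-M (suc (suc n)) = begin
  length (map Bᵛ (L (suc (suc n))) ++ map Cᵛ (M n) ++ map Eᵛ (L n))
    ≡⟨ length-++ (map Bᵛ (L (suc (suc n)))) ⟩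
  length (map Bᵛ (L (suc (suc n)))) + length (map Cᵛ (M n) ++ map Eᵛ (L n))
    ≡⟨ cong₂ _+_ (trans (length-map Bᵛ (L (suc (suc n)))) (length-L (suc (suc n)))) (length-++ (map Cᵛ (M n))) ⟩
  pellB (3 + n) + (length (map Cᵛ (M n)) + length (map Eᵛ (L n)))
    ≡⟨ cong (pellB (3 + n) +_) (cong₂ _+_ (trans (length-map Cᵛ (M n)) (length-M n)) (trans (length-map Eᵛ (L n)) (length-L n))) ⟩
  pellB (3 + n) + pellB (2 + n)
    ≡⟨ pell (pellA (2 + n)) (pellB (2 + n)) ⟩
  pellA (3 + n) ∎
  where
    open ≡-Reasoning
    pell : ∀ a b → (a + b) + b ≡ a + 2 * b
    pell = solve-∀

-- A sign-free form of a² - 2b² = ±1. The norm changes sign at each step, so each inequality follows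
-- from the other one.
pell-norm : ∀ j → let a = pellA j; b = pellB j in a * a ≤ 2 * (b * b) + 1 × 2 * (b * b) ≤ a * a + 1
pell-norm zero    = ℕ.≤-refl , z≤n
pell-norm (suc j) =
  (begin
    (a + 2 * b) * (a + 2 * b)                          ≡⟨ eq₁ a b ⟩
    (a * a + 4 * (a * b) + 2 * (b * b)) + 2 * (b * b)  ≤⟨ ℕ.+-monoʳ-≤ (a * a + 4 * (a * b) + 2 * (b * b)) (proj₂ ih) ⟩
    (a * a + 4 * (a * b) + 2 * (b * b)) + (a * a + 1)  ≡⟨ eq₂ a b ⟩
    2 * ((a + b) * (a + b)) + 1                        ∎) ,
  (begin
    2 * ((a + b) * (a + b))                                ≡⟨ eq₃ a b ⟩
    (a * a + 4 * (a * b) + 2 * (b * b)) + a * a            ≤⟨ ℕ.+-monoʳ-≤ (a * a + 4 * (a * b) + 2 * (b * b)) (proj₁ ih) ⟩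
    (a * a + 4 * (a * b) + 2 * (b * b)) + (2 * (b * b) + 1) ≡⟨ eq₄ a b ⟩
    (a + 2 * b) * (a + 2 * b) + 1                          ∎)
  where
    open ℕ.≤-Reasoning
    a = pellA j
    b = pellB j
    ih = pell-norm j
    eq₁ : ∀ a b → (a + 2 * b) * (a + 2 * b) ≡ (a * a + 4 * (a * b) + 2 * (b * b)) + 2 * (b * b)
    eq₁ = solve-∀
    eq₂ : ∀ a b → (a * a + 4 * (a * b) + 2 * (b * b)) + (a * a + 1) ≡ 2 * ((a + b) * (a + b)) + 1
    eq₂ = solve-∀
    eq₃ : ∀ a b → 2 * ((a + b) * (a + b)) ≡ (a * a + 4 * (a * b) + 2 * (b * b)) + a * a
    eq₃ = solve-∀
    eq₄ : ∀ a b → (a * a + 4 * (a * b) + 2 * (b * b)) + (2 * (b * b) + 1) ≡ (a + 2 * b) * (a + 2 * b) + 1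
    eq₄ = solve-∀

-- Since a is close to b√2, the bound is close to b. An m above b would make `2 * m ∸ b` at least b
-- + 2, and 2(b+2)² exceeds 2b² + 1, hence a², by 7 + 8b or more.
BelowBound⇒≤pellB : ∀ n m → BelowBound n m → m ≤ pellB (suc n)
BelowBound⇒≤pellB n m below with m ≤? pellB (suc n)
... | yes m≤b = m≤b
... | no m≰b = contradiction chain (ℕ.<⇒≱ (ℕ.m<m+n (2 * (b * b) + 1) z<s))
  where
    open ℕ.≤-Reasoning
    a = pellA (suc n)
    b = pellB (suc n)
    d = 2 * m ∸ b
    square : ∀ x → x ^ 2 ≡ x * x
    square x = cong (x *_) (ℕ.*-identityʳ x)
    b+2≤d : b + 2 ≤ d
    b+2≤d = ℕ.m+n≤o⇒m≤o∸n (b + 2) (begin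
      b + 2 + b      ≡⟨ twice b ⟩
      2 * suc b      ≤⟨ ℕ.*-monoʳ-≤ 2 (ℕ.≰⇒> m≰b) ⟩
      2 * m          ∎)
      where
        twice : ∀ b → b + 2 + b ≡ 2 * suc b
        twice = solve-∀
    expand : ∀ b → 2 * (b * b) + 1 + (7 + 8 * b) ≡ 2 * ((b + 2) * (b + 2))
    expand = solve-∀
    chain : 2 * (b * b) + 1 + (7 + 8 * b) ≤ 2 * (b * b) + 1
    chain = begin
      2 * (b * b) + 1 + (7 + 8 * b)    ≡⟨ expand b ⟩
      2 * ((b + 2) * (b + 2))          ≤⟨ ℕ.*-monoʳ-≤ 2 (ℕ.*-mono-≤ b+2≤d b+2≤d) ⟩
      2 * (d * d)                      ≡⟨ cong (2 *_) (sym (square d)) ⟩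
      2 * d ^ 2                        ≤⟨ below ⟩
      a ^ 2                            ≡⟨ square a ⟩
      a * a                            ≤⟨ proj₁ (pell-norm (suc n)) ⟩
      2 * (b * b) + 1                  ∎

theorem2p7 : (n m : ℕ) → BelowBound n m →
    Σ (List (ℕ × ℕ)) (λ vs → Unique vs × All (PlanarFeasible (n + 2)) vs × (m ≤ length vs))
theorem2p7 n m below =
  L n , unique-L n , All.map feasible (realizable-L n) ,
  subst (m ≤_) (sym (length-L n)) (BelowBound⇒≤pellB n m below)
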